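{- Let $n\ge 3$ be odd. Every valid configuration $(\sigma,\tau_s,\tau_{c_i},\rho_{c_i},\rho_{e_{i,j}},x,y_i,z)$ of the $n\times n\times n$ Rubik's Cube satisfies: (1) $\operatorname{sgn}(\sigma)=\operatorname{sgn}(\tau_s)=\operatorname{sgn}(\rho_{c_i})$ for every center corner orbit $i$; (2) $\operatorname{sgn}(\rho_{e_{i,j}})=\operatorname{sgn}(\sigma)\operatorname{sgn}(\tau_i)\operatorname{sgn}(\tau_j)$ for every center edge orbit $(i,j)$, where $\tau_k$ denotes $\tau_{c_k}$ and $\operatorname{sgn}(\tau_{(n+1)/2})$ is interpreted as $1$; (3) $\sum_{k=1}^8 x_k=0$ in $\mathbb{Z}_3$; (4) $\sum_{k=1}^{12} z_k=0$ in $\mathbb{Z}_2$; (5) $y_i=0$ for every coupled edge orbit $i$.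
   Context: Cube and moves: the $n\times n\times n$ Rubik's Cube has faces U, D, F, B, R, L, each an $n\times n$ grid of facelets carrying stickers; in the solved state each face is monochromatic with six distinct colors. For $1\le k\le\lfloor n/2\rfloor$, $F_k,B_k,R_k,L_k,U_k,D_k$ denote clockwise (seen from the named face) $90^\circ$ rotations of the $k$-th slice counted from the named face ($k=1$: face turns; $k>1$: internal slice rotations). A configuration is valid if it is obtained from the solved state by a sequence of these moves. Cubie types ($n$ odd): 8 corners (3 stickers); along each of the 12 edges lie edge cubies at positions $2,\dots,n-1$; the one at position $(n+1)/2$ is a single edge (12 total); for $2\le i\le (n-1)/2$ the 24 edge cubies at positions $i$ and $n+1-i$ form coupled edge orbit $i$. On each face index facelets $(r,c)$, $1\le r,c\le n$; for $2\le i\le (n-1)/2$ the center corner orbit $i$ is the 24 facelets with $r,c\in\{i,n+1-i\}$; for $2\le i\le (n-1)/2$, $2\le j\le (n+1)/2$, $j\ne i$, the center edge orbit $(i,j)$ is the 24 facelets occupying on each face the positions $(i,j),(j,n+1-i),(n+1-i,n+1-j),(n+1-j,i)$. Coordinates of a configuration: $\sigma\in S_8$ (permutation of corner cubies), $\tau_s\in S_{12}$ (single edges), $\tau_{c_i}\in S_{24}$ (coupled edges of orbit $i$), $\rho_{c_i}\in S_{24}$ (center corners of orbit $i$), $\rho_{e_{i,j}}\in S_{24}$ (center edges of orbit $(i,j)$), $x\in\mathbb{Z}_3^8$ (corner orientations), $y_i\in\mathbb{Z}_2^{24}$ (coupled edge orientations in orbit $i$), $z\in\mathbb{Z}_2^{12}$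 (single edge orientations); the solved state has identity permutations and zero orientations. Orientations: for corners, each corner cubie has exactly one sticker of the color of the (solved) white or yellow face, a designated pair of opposite faces; its orientation is $0$ if that sticker lies on the white or yellow face, $1$ if the cubie is rotated one step clockwise from orientation $0$, $2$ if two steps. For single edges, one of the two facelets of each single-edge position is fixed as reference facelet (a fixed choice for which all single edges have orientation 0 in the solved state); $z_k=0$ iff the sticker of the cubie at position $k$ that lay on a reference facelet in the solved state lies on a reference facelet. For coupled edges, call a coupled-edge facelet on face $X$ along the edge shared with face $Y$ left-handed if, viewing face $X$ from outside with that edge at the top, it lies left of the edge's midpoint; $y_{i,k}=0$ iff the sticker of the cubie at position $k$ of orbit $i$ that lay on a left-handed facelet in the solved state lies on a left-handed facelet. $\operatorname{sgn}$ is the sign of a permutation. -}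

module Defs where

-- Model of the n×n×n cube (n odd) with individually labelled stickers.
--
-- Geometry (doubled integer coordinates): the cube is [-n,n]^3, axis 0 = x
-- points to R, axis 1 = y points to U, axis 2 = z points to F (right-handed).
-- Cubie centres have coordinates in {-(n-1), -(n-3), ..., n-1}; the facelet
-- of a cubie on the face with outward normal ±e_a is the cubie centre with
-- coordinate a replaced by ±n.  A facelet position is thus a point of ℤ³.
--
-- A configuration is recorded as a map  d : P3 → P3  sending the (solved,
-- home) location of each sticker to its current location.  The solved
-- state is the identity; performing move m after d gives  m ∘ d.

open import Data.Nat as ℕ using (ℕ; zero; suc; _∸_; _≤_; _/_)
open import Data.Integer as ℤ using (ℤ; +_; -_; 1ℤ; -1ℤ)
open import Data.Bool using (Bool; true; false; if_then_else_)
open import Data.Product using (_×_; _,_; proj₁; proj₂)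
import Data.Product.Properties as ×P
open import Data.List as List using (List; []; _∷_; map; length; filter; concatMap; _++_)
open import Data.Vec as Vec using (Vec; []; _∷_)
open import Data.Fin using (Fin; zero; suc)
open import Function using (_∘_; id)
open import Relation.Nullary using (does)
open import Relation.Binary.Definitions using (DecidableEquality)

P3 : Set
P3 = ℤ × ℤ × ℤ

_≟₃_ : DecidableEquality P3
_≟₃_ = ×P.≡-dec ℤ._≟_ (×P.≡-dec ℤ._≟_ ℤ._≟_)

_==₃_ : P3 → P3 → Bool
p ==₃ q = does (p ≟₃ q)

member : P3 → List P3 → Bool
member p [] = false
member p (q ∷ qs) = if p ==₃ q then true else member p qs

indexOf : List P3 → P3 → ℕ
indexOf [] p = 0
indexOf (q ∷ qs) p = if q ==₃ p then 0 else suc (indexOf qs p)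

-- a permutation of {0,…,m-1} given by its list of images [π 0, …, π (m-1)]
inversions : List ℕ → ℕ
inversions [] = 0
inversions (a ∷ as) = length (filter (λ b → b ℕ.<? a) as) ℕ.+ inversions as

sgn : List ℕ → ℤ
sgn l = -1ℤ ℤ.^ inversions l

clampZ : ℕ → ℤ → ℤ
clampZ n v =
  if does (+ n ℤ.≤? v) then + (n ∸ 1)
  else if does (v ℤ.≤? - (+ n)) then - (+ (n ∸ 1))
  else v

-- the centre of the cubie a facelet belongs to
clamp : ℕ → P3 → P3
clamp n (x , y , z) = (clampZ n x , clampZ n y , clampZ n z)

-- push coordinate a of a (boundary) cubie centre out to the face: the
-- facelet of that cubie on the face with normal ±e_a
outZ : ℕ → ℤ → ℤ
outZ n v = if does (v ℤ.<? + 0) then - (+ n) else + n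

pushOut : ℕ → P3 → Fin 3 → P3
pushOut n (x , y , z) zero = (outZ n x , y , z)
pushOut n (x , y , z) (suc zero) = (x , outZ n y , z)
pushOut n (x , y , z) (suc (suc zero)) = (x , y , outZ n z)

data Face : Set where
  U D F B R L : Face

faces : List Face
faces = U ∷ D ∷ F ∷ B ∷ R ∷ L ∷ []

-- clockwise (seen from outside the named face) quarter turn of space,
-- i.e. rotation by -90° about the outward normal of the face
rot : Face → P3 → P3
rot R (x , y , z) = (x , z , - y)
rot L (x , y , z) = (x , - z , y)
rot U (x , y , z) = (- z , y , x)
rot D (x , y , z) = (z , y , - x)
rot F (x , y , z) = (y , - x , z)
rot B (x , y , z) = (- y , x , z)

depth : Face → P3 → ℤ
depth R (x , y , z) = x
depth L (x , y , z) = - x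
depth U (x , y , z) = y
depth D (x , y , z) = - y
depth F (x , y , z) = z
depth B (x , y , z) = - z

-- the move X_k : rotate the k-th slice counted from face X clockwise.
-- A facelet lies in slice k iff its cubie has depth n+1-2k.
move : ℕ → Face → ℕ → P3 → P3
move n f k p =
  if does (depth f (clamp n p) ℤ.≟ (+ suc n ℤ.- + (2 ℕ.* k)))
  then rot f p else p

data Valid (n : ℕ) : (P3 → P3) → Set where
  solved : Valid n id
  turn : ∀ {d} (f : Face) (k : ℕ) → 1 ≤ k → k ≤ n / 2 →
         Valid n d → Valid n (move n f k ∘ d)

-- Facelet grids (r,c) on the faces, 1 ≤ r,c ≤ n, row r counted from the
-- top, column c from the left, each face viewed from outside.

co : ℕ → ℕ → ℤ
co n r = + (2 ℕ.* r) ℤ.- + suc n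

facelet : ℕ → Face → ℕ → ℕ → P3
facelet n R r c = (+ n , - co n r , - co n c)
facelet n L r c = (- (+ n) , - co n r , co n c)
facelet n U r c = (co n c , + n , co n r)
facelet n D r c = (co n c , - (+ n) , - co n r)
facelet n F r c = (co n c , - co n r , + n)
facelet n B r c = (- co n c , - co n r , - (+ n))

onAllFaces : ℕ → List (ℕ × ℕ) → List P3
onAllFaces n pos = concatMap (λ f → map (λ rc → facelet n f (proj₁ rc) (proj₂ rc)) pos) faces

centerCornerOrbit : ℕ → ℕ → List P3
centerCornerOrbit n i =
  onAllFaces n ((i , i) ∷ (i , suc n ∸ i) ∷ (suc n ∸ i , suc n ∸ i) ∷ (suc n ∸ i , i) ∷ [])

centerEdgeOrbit : ℕ → ℕ → ℕ → List P3
centerEdgeOrbit n i j =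
  onAllFaces n ((i , j) ∷ (j , suc n ∸ i) ∷ (suc n ∸ i , suc n ∸ j) ∷ (suc n ∸ j , i) ∷ [])

signs : Vec ℤ 2
signs = 1ℤ ∷ -1ℤ ∷ []

E : ℕ → ℤ
E n = + (n ∸ 1)

cornerCenters : ℕ → List P3
cornerCenters n = Vec.toList
  (Vec.concat (Vec.map (λ sx → Vec.concat (Vec.map (λ sy → Vec.map (λ sz →
     (sx ℤ.* E n , sy ℤ.* E n , sz ℤ.* E n)) signs) signs)) signs))

pairOf : ℕ → P3 → Fin 3 → Fin 3 → P3 × P3
pairOf n c a b = (pushOut n c a , pushOut n c b)

-- the 12 edge cubies whose coordinate along their edge is t, each given by
-- its two facelets
edgesAt : ℕ → ℤ → Vec (P3 × P3) 12
edgesAt n t =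
  Vec.concat (Vec.map (λ s → Vec.map (λ s' → pairOf n (t , s ℤ.* E n , s' ℤ.* E n) (suc zero) (suc (suc zero))) signs) signs)
  Vec.++ (Vec.concat (Vec.map (λ s → Vec.map (λ s' → pairOf n (s ℤ.* E n , t , s' ℤ.* E n) zero (suc (suc zero))) signs) signs)
  Vec.++ Vec.concat (Vec.map (λ s → Vec.map (λ s' → pairOf n (s ℤ.* E n , s' ℤ.* E n , t) zero (suc zero)) signs) signs))

-- single edges (position (n+1)/2 along each edge)
singleEdges : ℕ → Vec (P3 × P3) 12
singleEdges n = edgesAt n (+ 0)

-- coupled edge orbit i : positions i and n+1-i along each edge
coupledEdges : ℕ → ℕ → List (P3 × P3)
coupledEdges n i = Vec.toList (edgesAt n (co n i)) ++ Vec.toList (edgesAt n (- co n i))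

-- Permutation coordinates.  For a list of tracked home facelets q_1..q_m
-- (one per piece) and an enumeration of the piece positions, the piece
-- starting at position j is now at position  indexOf targets (pos (d q_j)).

permOf : (P3 → P3) → List P3 → List P3 → (P3 → P3) → List ℕ
permOf d targets trackers pos = map (λ q → indexOf targets (pos (d q))) trackers

σ : ℕ → (P3 → P3) → List ℕ
σ n d = permOf d (cornerCenters n) (map (λ c → pushOut n c zero) (cornerCenters n)) (clamp n)

τs : ℕ → (P3 → P3) → List ℕ
τs n d = permOf d (Vec.toList (Vec.map (clamp n ∘ proj₁) (singleEdges n)))
                  (Vec.toList (Vec.map proj₁ (singleEdges n))) (clamp n)

τc : ℕ → ℕ → (P3 → P3) → List ℕ
τc n i d = permOf d (map (clamp n ∘ proj₁) (coupledEdges n i))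
                    (map proj₁ (coupledEdges n i)) (clamp n)

ρc : ℕ → ℕ → (P3 → P3) → List ℕ
ρc n i d = permOf d (centerCornerOrbit n i) (centerCornerOrbit n i) id

ρe : ℕ → ℕ → ℕ → (P3 → P3) → List ℕ
ρe n i j d = permOf d (centerEdgeOrbit n i j) (centerEdgeOrbit n i j) id

sgnτ : ℕ → ℕ → (P3 → P3) → ℤ
sgnτ n j d = if j ℕ.≡ᵇ suc (n / 2) then 1ℤ else sgn (τc n j d)

-- Corner orientations.  ax : Fin 3 is the axis of the designated pair of
-- opposite faces (white/yellow).

sgnZ : ℤ → ℤ
sgnZ v = if does (v ℤ.<? + 0) then -1ℤ else 1ℤ

axisOf : ℕ → P3 → Fin 3
axisOf n (x , y , z) =
  if ℤ.∣ x ∣ ℕ.≡ᵇ n then zero else if ℤ.∣ y ∣ ℕ.≡ᵇ n then suc zero else suc (suc zero)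

prevAx nextAx : Fin 3 → Fin 3
prevAx zero = suc (suc zero)
prevAx (suc zero) = zero
prevAx (suc (suc zero)) = suc zero
nextAx zero = suc zero
nextAx (suc zero) = suc (suc zero)
nextAx (suc (suc zero)) = zero

-- next facelet of the same corner in clockwise order, seen from outside the
-- corner.  At a corner with sign vector (sx,sy,sz) the face axes x,y,z occur
-- counterclockwise iff sx·sy·sz = 1, so clockwise the axis goes b ↦ b-1
-- if sx·sy·sz = 1 and b ↦ b+1 otherwise.
cw : ℕ → P3 → P3
cw n p with clamp n p
... | (x , y , z) =
  pushOut n (x , y , z)
    (if does ((sgnZ x ℤ.* sgnZ y ℤ.* sgnZ z) ℤ.≟ 1ℤ)
     then prevAx (axisOf n p) else nextAx (axisOf n p))

-- orientation (0,1,2) of the corner cubie with home centre c0: the number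
-- of clockwise steps from the ax-facelet of its current position to the
-- current location of its ax-coloured sticker
cornerOri : ℕ → Fin 3 → (P3 → P3) → P3 → ℕ
cornerOri n ax d c0 =
  let loc = d (pushOut n c0 ax)
      f0  = pushOut n (clamp n loc) ax
  in if loc ==₃ f0 then 0 else if loc ==₃ cw n f0 then 1 else 2

xo : ℕ → Fin 3 → (P3 → P3) → List ℕ
xo n ax d = map (cornerOri n ax d) (cornerCenters n)

-- Single edge orientations.  ref k chooses which of the two facelets of
-- single-edge position k is the reference facelet.

choose : Bool → P3 × P3 → P3
choose false = proj₁
choose true  = proj₂

refFacelets : ℕ → (Fin 12 → Bool) → List P3
refFacelets n ref = Vec.toList (Vec.tabulate (λ k → choose (ref k) (Vec.lookup (singleEdges n) k)))

zo : ℕ → (Fin 12 → Bool) → (P3 → P3) → List ℕ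
zo n ref d = Vec.toList (Vec.tabulate (λ k →
  if member (d (choose (ref k) (Vec.lookup (singleEdges n) k))) (refFacelets n ref) then 0 else 1))

sub3 : P3 → P3 → P3
sub3 (a , b , c) (a' , b' , c') = (a ℤ.- a' , b ℤ.- b' , c ℤ.- c')

cross : P3 → P3 → P3
cross (a , b , c) (a' , b' , c') =
  (b ℤ.* c' ℤ.- c ℤ.* b' , c ℤ.* a' ℤ.- a ℤ.* c' , a ℤ.* b' ℤ.- b ℤ.* a')

dot : P3 → P3 → ℤ
dot (a , b , c) (a' , b' , c') = a ℤ.* a' ℤ.+ b ℤ.* b' ℤ.+ c ℤ.* c'

extZ : ℕ → ℤ → ℤ
extZ n v = if does (v ℤ.≟ E n) then 1ℤ else if does (v ℤ.≟ - E n) then -1ℤ else + 0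

ext : ℕ → P3 → P3
ext n (x , y , z) = (extZ n x , extZ n y , extZ n z)

-- A facelet p of an edge cubie with centre c = clamp p lies on the face X
-- with unit outward normal N = p - c; the other face Y of the cubie has
-- normal M = ext c - N.  Viewing X from outside with the shared edge at the
-- top (up = M), the leftward direction is N × M; p is left-handed iff its
-- cubie lies on that side of the edge's midpoint.
leftHanded : ℕ → P3 → Bool
leftHanded n p =
  let c = clamp n p
      N = sub3 p c
      M = sub3 (ext n c) N
  in does (+ 0 ℤ.<? dot (cross N M) c)

leftOf : ℕ → P3 × P3 → P3
leftOf n pr = if leftHanded n (proj₁ pr) then proj₁ pr else proj₂ pr

yo : ℕ → ℕ → (P3 → P3) → List ℕ
yo n i d = map (λ pr → if leftHanded n (d (leftOf n pr)) then 0 else 1) (coupledEdges n i)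

{-# OPTIONS --safe #-}
module Submission where

-- Only n, n − 1, 0 and the coordinates ± (n + 1 − 2i), ± (n + 1 − 2j) of the
-- rows in question occur as coordinates of a tracked piece.  Replacing these
-- numbers by letters turns each orbit into a fixed finite set on which the
-- slice turns act independently of n (a slice through none of the letters acts
-- trivially), so every claim about a single turn is a finite computation.
--
-- Signs: the sign of a permutation is a product over unordered pairs of
-- pieces, which makes it multiplicative; hence relations between signs only
-- have to be checked on single turns.  Orientation sums: a turn changes the
-- orientation of a sticker by an amount depending only on the cubie it lies
-- on, and these amounts add up to 0.  Changing the reference facelets of the
-- single edges alters the sum by twice the sum of the changes.  Turns preserve
-- left-handedness of coupled-edge facelets.

open import Defs
open import Data.Bool as Bool using (Bool; true; false; if_then_else_; not; _∧_; _∨_; _xor_)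
open import Data.Bool.Properties using (∨-identityʳ)
open import Data.Fin as Fin using (Fin; zero; suc)
open import Data.Fin.Properties using (any?)
open import Data.Integer as ℤ using (ℤ; +_; -_; _*_; 0ℤ; 1ℤ; -1ℤ)
import Data.Integer.Properties as ℤ
open import Data.Integer.Tactic.RingSolver using (solve-∀)
open import Data.List using (List; []; _∷_; _++_; allFin; cartesianProduct; concatMap; filter; foldr; length; map)
open import Data.List.Membership.DecPropositional using (_∈?_)
open import Data.List.Membership.Propositional using (_∈_)
open import Data.List.Membership.Propositional.Properties using (∈-++⁺ˡ; ∈-allFin; ∈-cartesianProduct⁺; ∈-map⁺)
open import Data.List.Properties using (concatMap-cong; filter-accept; filter-reject; map-cong; map-id; map-∘)
open import Data.List.Relation.Binary.Permutation.Propositional as ↭ using (_↭_; ↭-reflexive; ↭-trans)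
open import Data.List.Relation.Binary.Permutation.Propositional.Properties using (map⁺; ∈-resp-↭)
open import Data.List.Relation.Unary.All as All using (All; []; _∷_)
import Data.List.Relation.Unary.All.Properties as All
open import Data.List.Relation.Unary.Any using (here; there)
open import Data.Maybe as Maybe using (Maybe; just; nothing; is-just)
open import Data.Nat as ℕ using (ℕ; zero; suc; _≤_; _/_; _%_; NonZero)
open import Data.Nat.DivMod using (%-distribˡ-+; [m+kn]%n≡m%n; m/n*n≤m; m≡m%n+[m/n]*n)
open import Data.Nat.ListAction using (sum)
open import Data.Nat.ListAction.Properties using (sum-↭)
import Data.Nat.Properties as ℕ
open import Data.Nat.Tactic.RingSolver using () renaming (solve-∀ to solveℕ-∀)
open import Data.Product using (∃; _×_; _,_; proj₁; proj₂)
import Data.Product.Properties as ×P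
open import Data.Sum using (_⊎_; inj₁; inj₂; [_,_]′)
open import Data.Vec as Vec using (Vec; []; _∷_)
open import Data.Vec.Membership.Propositional.Properties using (∈-lookup; ∈-toList⁺)
open import Data.Vec.Properties using (lookup-map; tabulate-cong)
open import Function using (_∘_; id; mk⇔)
open import Level using (Level)
open import Relation.Binary.Definitions using (DecidableEquality)
open import Relation.Binary.PropositionalEquality using (_≡_; _≢_; refl; sym; trans; cong; cong₂; module ≡-Reasoning; subst)
open import Relation.Nullary using (¬_; Dec; yes; no; does; contradiction)
open import Relation.Nullary.Decidable using (_×-dec_; dec-false; dec-true; does-⇔)

private variable
  a : Level
  A : Set a
  m : ℕ

-- Signs of permutations

prodℤ : List ℤ → ℤ
prodℤ = foldr _*_ 1ℤ

*-interchange : ∀ x y z w → (x * y) * (z * w) ≡ (x * z) * (y * w)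
*-interchange = solve-∀

prodℤ-map-* : ∀ (f g : A → ℤ) xs →
  prodℤ (map f xs) * prodℤ (map g xs) ≡ prodℤ (map (λ x → f x * g x) xs)
prodℤ-map-* f g [] = refl
prodℤ-map-* f g (x ∷ xs) = trans
  (*-interchange (f x) (prodℤ (map f xs)) (g x) (prodℤ (map g xs)))
  (cong ((f x * g x) *_) (prodℤ-map-* f g xs))

*-left-comm : ∀ x y z → x * (y * z) ≡ y * (x * z)
*-left-comm = solve-∀

prodℤ-↭ : ∀ {xs ys} → xs ↭ ys → prodℤ xs ≡ prodℤ ys
prodℤ-↭ ↭.refl = refl
prodℤ-↭ (↭.prep x p) = cong (x *_) (prodℤ-↭ p)
prodℤ-↭ (↭.swap x y p) = trans (*-left-comm x y _) (cong (λ t → y * (x * t)) (prodℤ-↭ p))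
prodℤ-↭ (↭.trans p q) = trans (prodℤ-↭ p) (prodℤ-↭ q)

pairProd : (A → A → ℤ) → List A → ℤ
pairProd r [] = 1ℤ
pairProd r (x ∷ xs) = prodℤ (map (r x) xs) * pairProd r xs

pairProd-* : ∀ (r s : A → A → ℤ) xs →
  pairProd r xs * pairProd s xs ≡ pairProd (λ x y → r x y * s x y) xs
pairProd-* r s [] = refl
pairProd-* r s (x ∷ xs) = trans
  (*-interchange (prodℤ (map (r x) xs)) (pairProd r xs) (prodℤ (map (s x) xs)) (pairProd s xs))
  (cong₂ _*_ (prodℤ-map-* (r x) (s x) xs) (pairProd-* r s xs))

pairProd-map : ∀ {b} {B : Set b} (r : B → B → ℤ) (f : A → B) xs →
  pairProd r (map f xs) ≡ pairProd (λ x y → r (f x) (f y)) xs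
pairProd-map r f [] = refl
pairProd-map r f (x ∷ xs) = cong₂ _*_ (cong prodℤ (sym (map-∘ xs))) (pairProd-map r f xs)

-- Symmetry of `r` is needed only for an adjacent swap, which trades the factor `r x y` for `r y x`;
-- everything else is reordering of products.
pairProd-↭ : (r : A → A → ℤ) → (∀ x y → r x y ≡ r y x) →
  ∀ {xs ys} → xs ↭ ys → pairProd r xs ≡ pairProd r ys
pairProd-↭ r r-sym ↭.refl = refl
pairProd-↭ r r-sym (↭.prep x p) =
  cong₂ _*_ (prodℤ-↭ (map⁺ (r x) p)) (pairProd-↭ r r-sym p)
pairProd-↭ r r-sym (↭.swap {xs} {ys} x y p) = begin
  (r x y * prodℤ (map (r x) xs)) * (prodℤ (map (r y) xs) * pairProd r xs)
    ≡⟨ *-interchange (r x y) (prodℤ (map (r x) xs)) (prodℤ (map (r y) xs)) (pairProd r xs) ⟩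
  (r x y * prodℤ (map (r y) xs)) * (prodℤ (map (r x) xs) * pairProd r xs)
    ≡⟨ cong₂ _*_ (cong₂ _*_ (r-sym x y) (prodℤ-↭ (map⁺ (r y) p)))
                 (cong₂ _*_ (prodℤ-↭ (map⁺ (r x) p)) (pairProd-↭ r r-sym p)) ⟩
  (r y x * prodℤ (map (r y) ys)) * (prodℤ (map (r x) ys) * pairProd r ys) ∎
  where open ≡-Reasoning
pairProd-↭ r r-sym (↭.trans p q) = trans (pairProd-↭ r r-sym p) (pairProd-↭ r r-sym q)

-- The sign of b − a.
signum : ℕ → ℕ → ℤ
signum zero zero = 0ℤ
signum zero (suc b) = 1ℤ
signum (suc a) zero = -1ℤ
signum (suc a) (suc b) = signum a b

signum-antisym : ∀ a b → signum a b ≡ - signum b a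
signum-antisym zero zero = refl
signum-antisym zero (suc b) = refl
signum-antisym (suc a) zero = refl
signum-antisym (suc a) (suc b) = signum-antisym a b

signum-> : ∀ {a b} → b ℕ.< a → signum a b ≡ -1ℤ
signum-> {suc a} {zero} _ = refl
signum-> {suc a} {suc b} (ℕ.s≤s b<a) = signum-> b<a

signum-≤ : ∀ {a b} → a ≤ b → signum a b ≡ 0ℤ ⊎ signum a b ≡ 1ℤ
signum-≤ {zero} {zero} _ = inj₁ refl
signum-≤ {zero} {suc b} _ = inj₂ refl
signum-≤ {suc a} {suc b} (ℕ.s≤s a≤b) = signum-≤ a≤b

-- The sign of the Vandermonde determinant of the list: 0 if an entry repeats, otherwise -1 to the
-- number of inversions. As a product over pairs it can be multiplied and rearranged factor by
-- factor, unlike a count of inversions.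
vandermonde : List ℕ → ℤ
vandermonde = pairProd signum

private
  zero-or-* : ∀ {x y u v} → x ≡ 0ℤ ⊎ x ≡ u → y ≡ 0ℤ ⊎ y ≡ v → x * y ≡ 0ℤ ⊎ x * y ≡ u * v
  zero-or-* (inj₁ refl) _ = inj₁ refl
  zero-or-* {x} (inj₂ _) (inj₁ refl) = inj₁ (ℤ.*-zeroʳ x)
  zero-or-* (inj₂ refl) (inj₂ refl) = inj₂ refl

  -- Each smaller entry contributes -1, each larger one 1, and an entry equal to `a` makes the whole
  -- product 0.
  head-factor : ∀ a as → let c = prodℤ (map (signum a) as) in
    c ≡ 0ℤ ⊎ c ≡ -1ℤ ℤ.^ length (filter (λ b → b ℕ.<? a) as)
  head-factor a [] = inj₂ refl
  head-factor a (b ∷ as) with b ℕ.<? a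
  ... | yes b<a rewrite filter-accept (λ b → b ℕ.<? a) {xs = as} b<a =
    zero-or-* {v = -1ℤ ℤ.^ length (filter (λ b → b ℕ.<? a) as)} (inj₂ (signum-> b<a)) (head-factor a as)
  ... | no b≮a rewrite filter-reject (λ b → b ℕ.<? a) {xs = as} b≮a =
    subst (λ t → prodℤ (map (signum a) (b ∷ as)) ≡ 0ℤ ⊎ prodℤ (map (signum a) (b ∷ as)) ≡ t)
      (ℤ.*-identityˡ (-1ℤ ℤ.^ length (filter (λ b → b ℕ.<? a) as)))
      (zero-or-* (signum-≤ (ℕ.≮⇒≥ b≮a)) (head-factor a as))

  vandermonde-zero-or-sgn : ∀ l → vandermonde l ≡ 0ℤ ⊎ vandermonde l ≡ sgn l
  vandermonde-zero-or-sgn [] = inj₂ refl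
  vandermonde-zero-or-sgn (a ∷ as) = subst (λ t → vandermonde (a ∷ as) ≡ 0ℤ ⊎ vandermonde (a ∷ as) ≡ t)
    (sym (ℤ.^-distribˡ-+-* -1ℤ (length (filter (λ b → b ℕ.<? a) as)) (inversions as)))
    (zero-or-* (head-factor a as) (vandermonde-zero-or-sgn as))

-- Nonvanishing stands in for a proof that the entries are distinct; for words of moves it follows
-- from the square being 1.
sgn≡vandermonde : ∀ l → vandermonde l ≢ 0ℤ → sgn l ≡ vandermonde l
sgn≡vandermonde l v≢0 with vandermonde-zero-or-sgn l
... | inj₁ v≡0 = contradiction v≡0 v≢0
... | inj₂ v≡s = sym v≡s

-- The relative sign of two labellings of a list is a product over unordered
-- pairs, hence does not depend on the order of the list.
vandermonde-relative-↭ : ∀ (f g : A → ℕ) {xs ys} → xs ↭ ys →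
  vandermonde (map f xs) * vandermonde (map g xs) ≡ vandermonde (map f ys) * vandermonde (map g ys)
vandermonde-relative-↭ {A = A} f g {xs} {ys} p =
  trans (toPairs xs) (trans (pairProd-↭ r r-sym p) (sym (toPairs ys)))
  where
  r : A → A → ℤ
  r x y = signum (f x) (f y) * signum (g x) (g y)
  r-sym : ∀ x y → r x y ≡ r y x
  r-sym x y = trans (cong₂ _*_ (signum-antisym (f x) (f y)) (signum-antisym (g x) (g y)))
                    (neg-*-neg (signum (f y) (f x)) (signum (g y) (g x)))
    where
    neg-*-neg : ∀ u v → (- u) * (- v) ≡ u * v
    neg-*-neg = solve-∀
  toPairs : ∀ zs → vandermonde (map f zs) * vandermonde (map g zs) ≡ pairProd r zs
  toPairs zs = trans (cong₂ _*_ (pairProd-map signum f zs) (pairProd-map signum g zs))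
                     (pairProd-* _ _ zs)

-- Sums of labels modulo r

+-interchange : ∀ s t u v → s ℕ.+ t ℕ.+ (u ℕ.+ v) ≡ s ℕ.+ u ℕ.+ (t ℕ.+ v)
+-interchange = solveℕ-∀

sum-map-+ : ∀ (f g : A → ℕ) xs →
  sum (map (λ x → f x ℕ.+ g x) xs) ≡ sum (map f xs) ℕ.+ sum (map g xs)
sum-map-+ f g [] = refl
sum-map-+ f g (x ∷ xs) = trans (cong (f x ℕ.+ g x ℕ.+_) (sum-map-+ f g xs))
  (+-interchange (f x) (g x) (sum (map f xs)) (sum (map g xs)))

sum-map-cong-% : ∀ (r : ℕ) .{{_ : NonZero r}} (f g h : A → ℕ) {xs} →
  All (λ x → f x % r ≡ (g x ℕ.+ h x) % r) xs →
  sum (map f xs) % r ≡ (sum (map g xs) ℕ.+ sum (map h xs)) % r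
sum-map-cong-% r f g h [] = refl
sum-map-cong-% r f g h {x ∷ xs} (e ∷ es) = begin
  (f x ℕ.+ sum (map f xs)) % r
    ≡⟨ %-distribˡ-+ (f x) _ r ⟩
  (f x % r ℕ.+ sum (map f xs) % r) % r
    ≡⟨ cong₂ (λ s t → (s ℕ.+ t) % r) e (sum-map-cong-% r f g h es) ⟩
  ((g x ℕ.+ h x) % r ℕ.+ (sum (map g xs) ℕ.+ sum (map h xs)) % r) % r
    ≡⟨ %-distribˡ-+ (g x ℕ.+ h x) _ r ⟨
  (g x ℕ.+ h x ℕ.+ (sum (map g xs) ℕ.+ sum (map h xs))) % r
    ≡⟨ cong (_% r) (+-interchange (g x) (h x) (sum (map g xs)) (sum (map h xs))) ⟩
  (g x ℕ.+ sum (map g xs) ℕ.+ (h x ℕ.+ sum (map h xs))) % r ∎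
  where
  open ≡-Reasoning

-- Searching for permutations between lists

module _ (_≟_ : DecidableEquality A) where

  -- The search returns the permutation itself, so evaluating it on closed lists yields a proof; a
  -- failed search asserts nothing.
  extract : ∀ x ys → Maybe (∃ λ zs → x ∷ zs ↭ ys)
  extract x [] = nothing
  extract x (y ∷ ys) with x ≟ y
  ... | yes refl = just (ys , ↭.refl)
  ... | no _ = Maybe.map (λ (zs , p) → y ∷ zs , ↭-trans (↭.swap x y ↭.refl) (↭.prep y p)) (extract x ys)

  findPermutation : ∀ xs ys → Maybe (xs ↭ ys)
  findPermutation [] [] = just ↭.refl
  findPermutation [] (_ ∷ _) = nothing
  findPermutation (x ∷ xs) ys with extract x ys
  ... | nothing = nothing
  ... | just (zs , p) = Maybe.map (λ q → ↭-trans (↭.prep x q) p) (findPermutation xs zs)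

-- The cube over an alphabet of coordinates

-- Coordinates up to the relevant distinctions: letter 0 stands for n, letter 1
-- for n − 1, and the m remaining letters for slices strictly between the
-- middle one and a face.
data Sym (m : ℕ) : Set where
  mid : Sym m
  pos neg : Fin (2 ℕ.+ m) → Sym m

Sym3 : ℕ → Set
Sym3 m = Sym m × Sym m × Sym m

_≟ₛ_ : DecidableEquality (Sym m)
mid ≟ₛ mid = yes refl
mid ≟ₛ pos _ = no λ ()
mid ≟ₛ neg _ = no λ ()
pos _ ≟ₛ mid = no λ ()
pos i ≟ₛ pos j with i Fin.≟ j
... | yes refl = yes refl
... | no i≢j = no λ { refl → i≢j refl }
pos _ ≟ₛ neg _ = no λ ()
neg _ ≟ₛ mid = no λ ()
neg _ ≟ₛ pos _ = no λ ()
neg i ≟ₛ neg j with i Fin.≟ j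
... | yes refl = yes refl
... | no i≢j = no λ { refl → i≢j refl }

_≟ₛ₃_ : DecidableEquality (Sym3 m)
_≟ₛ₃_ = ×P.≡-dec _≟ₛ_ (×P.≡-dec _≟ₛ_ _≟ₛ_)

negₛ : Sym m → Sym m
negₛ mid = mid
negₛ (pos i) = neg i
negₛ (neg i) = pos i

clampₛ : Sym m → Sym m
clampₛ (pos zero) = pos (suc zero)
clampₛ (neg zero) = neg (suc zero)
clampₛ s = s

clampₛ₃ : Sym3 m → Sym3 m
clampₛ₃ (x , y , z) = clampₛ x , clampₛ y , clampₛ z

outₛ : Sym m → Sym m
outₛ (neg _) = neg zero
outₛ _ = pos zero

pushOutₛ : Sym3 m → Fin 3 → Sym3 m
pushOutₛ (x , y , z) zero = outₛ x , y , z
pushOutₛ (x , y , z) (suc zero) = x , outₛ y , z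
pushOutₛ (x , y , z) (suc (suc zero)) = x , y , outₛ z

rotₛ : Face → Sym3 m → Sym3 m
rotₛ R (x , y , z) = x , z , negₛ y
rotₛ L (x , y , z) = x , negₛ z , y
rotₛ U (x , y , z) = negₛ z , y , x
rotₛ D (x , y , z) = z , y , negₛ x
rotₛ F (x , y , z) = y , negₛ x , z
rotₛ B (x , y , z) = negₛ y , x , z

depthₛ : Face → Sym3 m → Sym m
depthₛ R (x , y , z) = x
depthₛ L (x , y , z) = negₛ x
depthₛ U (x , y , z) = y
depthₛ D (x , y , z) = negₛ y
depthₛ F (x , y , z) = z
depthₛ B (x , y , z) = negₛ z

-- Cubie centres never have coordinate ± n, so (f , zero) acts trivially; it
-- stands for every slice that misses all letters.
Move : ℕ → Set
Move m = Face × Fin (2 ℕ.+ m)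

act : Move m → Sym3 m → Sym3 m
act (f , q) p = if does (depthₛ f (clampₛ₃ p) ≟ₛ pos q) then rotₛ f p else p

-- The head of the word is the move performed last, as in `turn`.
run : List (Move m) → Sym3 m → Sym3 m
run [] = id
run (g ∷ w) = act g ∘ run w

negₛ-clampₛ : (s : Sym m) → negₛ (clampₛ s) ≡ clampₛ (negₛ s)
negₛ-clampₛ mid = refl
negₛ-clampₛ (pos zero) = refl
negₛ-clampₛ (pos (suc _)) = refl
negₛ-clampₛ (neg zero) = refl
negₛ-clampₛ (neg (suc _)) = refl

clampₛ-idem : (s : Sym m) → clampₛ (clampₛ s) ≡ clampₛ s
clampₛ-idem mid = refl
clampₛ-idem (pos zero) = refl
clampₛ-idem (pos (suc _)) = refl
clampₛ-idem (neg zero) = refl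
clampₛ-idem (neg (suc _)) = refl

clampₛ₃-idem : (p : Sym3 m) → clampₛ₃ (clampₛ₃ p) ≡ clampₛ₃ p
clampₛ₃-idem (x , y , z) = cong₂ _,_ (clampₛ-idem x) (cong₂ _,_ (clampₛ-idem y) (clampₛ-idem z))

depthₛ-clampₛ₃ : ∀ f (p : Sym3 m) → depthₛ f (clampₛ₃ p) ≡ clampₛ (depthₛ f p)
depthₛ-clampₛ₃ R _ = refl
depthₛ-clampₛ₃ L (x , _) = negₛ-clampₛ x
depthₛ-clampₛ₃ U _ = refl
depthₛ-clampₛ₃ D (_ , y , _) = negₛ-clampₛ y
depthₛ-clampₛ₃ F _ = refl
depthₛ-clampₛ₃ B (_ , _ , z) = negₛ-clampₛ z

rotₛ-clampₛ₃ : ∀ f (p : Sym3 m) → rotₛ f (clampₛ₃ p) ≡ clampₛ₃ (rotₛ f p)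
rotₛ-clampₛ₃ R (x , y , z) = cong (λ t → _ , _ , t) (negₛ-clampₛ y)
rotₛ-clampₛ₃ L (x , y , z) = cong (λ t → _ , t , _) (negₛ-clampₛ z)
rotₛ-clampₛ₃ U (x , y , z) = cong (λ t → t , _ , _) (negₛ-clampₛ z)
rotₛ-clampₛ₃ D (x , y , z) = cong (λ t → _ , _ , t) (negₛ-clampₛ x)
rotₛ-clampₛ₃ F (x , y , z) = cong (λ t → _ , t , _) (negₛ-clampₛ x)
rotₛ-clampₛ₃ B (x , y , z) = cong (λ t → t , _ , _) (negₛ-clampₛ y)

act-clampₛ₃ : ∀ (g : Move m) p → act g (clampₛ₃ p) ≡ clampₛ₃ (act g p)
-- Idempotence of clamping makes the slice tests on both sides the same Boolean, so one case split
-- settles them.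
act-clampₛ₃ (f , q) p rewrite clampₛ₃-idem p with does (depthₛ f (clampₛ₃ p) ≟ₛ pos q)
... | true = rotₛ-clampₛ₃ f p
... | false = refl

run-clampₛ₃ : ∀ (w : List (Move m)) p → run w (clampₛ₃ p) ≡ clampₛ₃ (run w p)
run-clampₛ₃ [] p = refl
run-clampₛ₃ (g ∷ w) p = trans (cong (act g) (run-clampₛ₃ w p)) (act-clampₛ₃ g (run w p))

-- Finite checks over all moves

allMoves : ∀ m → List (Move m)
allMoves m = cartesianProduct faces (allFin (2 ℕ.+ m))

∈-faces : ∀ f → f ∈ faces
∈-faces U = here refl
∈-faces D = there (here refl)
∈-faces F = there (there (here refl))
∈-faces B = there (there (there (here refl)))
∈-faces R = there (there (there (there (here refl))))
∈-faces L = there (there (there (there (there (here refl)))))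

∈-allMoves : (g : Move m) → g ∈ allMoves m
∈-allMoves (f , q) = ∈-cartesianProduct⁺ (∈-faces f) (∈-allFin q)

-- The hypothesis concerns only the Boolean `does P?`, so `refl` discharges it by evaluating the
-- answer and not the evidence.
decide : ∀ {p} {P : Set p} (P? : Dec P) → does P? ≡ true → P
decide (yes p) _ = p

forMoves : ∀ {p} {P : Move m → Set p} (P? : ∀ g → Dec (P g)) →
  does (All.all? P? (allMoves m)) ≡ true → ∀ g → P g
forMoves P? ok g = All.lookup (decide (All.all? P? (allMoves _)) ok) (∈-allMoves g)

Stable : List (Sym3 m) → Set
Stable T = ∀ g → map (act g) T ↭ T

stable? : (T : List (Sym3 m)) (g : Move m) → Maybe (map (act g) T ↭ T)
stable? T g = findPermutation _≟ₛ₃_ (map (act g) T) T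

checkStable : (T : List (Sym3 m)) →
  does (All.all? (λ g → Bool.T? (is-just (stable? T g))) (allMoves m)) ≡ true → Stable T
checkStable T ok g = fromIsJust (stable? T g) (forMoves (λ g → Bool.T? (is-just (stable? T g))) ok g)
  where
  fromIsJust : ∀ {A : Set} (x : Maybe A) → Bool.T (is-just x) → A
  fromIsJust (just a) _ = a

run-↭ : ∀ {T : List (Sym3 m)} → Stable T → ∀ w → map (run w) T ↭ T
run-↭ {T = T} st [] = ↭-reflexive (map-id T)
run-↭ {T = T} st (g ∷ w) =
  ↭-trans (↭-reflexive (map-∘ T)) (↭-trans (map⁺ (act g) (run-↭ st w)) (st g))

run-∈ : ∀ {T : List (Sym3 m)} → Stable T → ∀ w {p} → p ∈ T → run w p ∈ T
run-∈ st w p∈T = ∈-resp-↭ (run-↭ st w) (∈-map⁺ (run w) p∈T)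

-- Signs of words of moves

indexOfₛ : List (Sym3 m) → Sym3 m → ℕ
indexOfₛ [] p = 0
indexOfₛ (q ∷ qs) p = if does (q ≟ₛ₃ p) then 0 else suc (indexOfₛ qs p)

permₛ : List (Sym3 m) → (Sym3 m → Sym3 m) → List ℕ
permₛ T d = map (indexOfₛ T ∘ d) T

moveSign : List (Sym3 m) → Move m → ℤ
moveSign T g = vandermonde (permₛ T (act g))

-- `moveSign²` says that every move has sign 1 or -1, which lets signs be cancelled and rules out
-- repeated indices. `vandermonde-id` rules out repetitions in `T` itself.
record Orbit (T : List (Sym3 m)) : Set where
  field
    stable : Stable T
    moveSign² : ∀ g → moveSign T g * moveSign T g ≡ 1ℤ
    vandermonde-id : vandermonde (permₛ T id) ≡ 1ℤ

checkOrbit : (T : List (Sym3 m)) →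
  does (All.all? (λ g → Bool.T? (is-just (stable? T g))) (allMoves m)) ≡ true →
  does (All.all? (λ g → moveSign T g * moveSign T g ℤ.≟ 1ℤ) (allMoves m)) ≡ true →
  vandermonde (permₛ T id) ≡ 1ℤ → Orbit T
checkOrbit T st sq v = record
  { stable = checkStable T st
  ; moveSign² = forMoves (λ g → moveSign T g * moveSign T g ℤ.≟ 1ℤ) sq
  ; vandermonde-id = v }

wordSign : List (Sym3 m) → List (Move m) → ℤ
wordSign T w = prodℤ (map (moveSign T) w)

module _ {T : List (Sym3 m)} (orbit : Orbit T) where
  open Orbit orbit
  open ≡-Reasoning

  private
    *-square-1 : ∀ {x y z} → z * z ≡ 1ℤ → x * z ≡ y → x ≡ y * z
    *-square-1 {x} {y} {z} z² e = begin
      x             ≡⟨ ℤ.*-identityʳ x ⟨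
      x * 1ℤ        ≡⟨ cong (x *_) z² ⟨
      x * (z * z)   ≡⟨ ℤ.*-assoc x z z ⟨
      x * z * z     ≡⟨ cong (_* z) e ⟩
      y * z         ∎

  wordSign² : ∀ w → wordSign T w * wordSign T w ≡ 1ℤ
  wordSign² [] = refl
  wordSign² (g ∷ w) = trans
    (*-interchange (moveSign T g) (wordSign T w) (moveSign T g) (wordSign T w))
    (cong₂ _*_ (moveSign² g) (wordSign² w))

  -- The labellings `indexOfₛ T ∘ act g` and `indexOfₛ T` have the same relative sign on
  -- `map (run w) T` as on `T`, because `run w` permutes `T`. The former is the product of the
  -- values for `g ∷ w` and `w`, the latter is `moveSign T g`; the value for `w` has square 1 and
  -- can be moved across.
  vandermonde-run : ∀ w → vandermonde (permₛ T (run w)) ≡ wordSign T w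
  vandermonde-run [] = vandermonde-id
  vandermonde-run (g ∷ w) = *-square-1 (wordSign² w) (begin
    vandermonde (permₛ T (act g ∘ run w)) * wordSign T w
      ≡⟨ cong₂ _*_ (cong vandermonde (map-∘ T)) (sym (vandermonde-run w)) ⟩
    vandermonde (map (indexOfₛ T ∘ act g) (map (run w) T)) * vandermonde (permₛ T (run w))
      ≡⟨ cong (λ l → vandermonde (map (indexOfₛ T ∘ act g) (map (run w) T)) * vandermonde l) (map-∘ T) ⟩
    vandermonde (map (indexOfₛ T ∘ act g) (map (run w) T)) * vandermonde (map (indexOfₛ T) (map (run w) T))
      ≡⟨ vandermonde-relative-↭ (indexOfₛ T ∘ act g) (indexOfₛ T) (run-↭ stable w) ⟩
    moveSign T g * vandermonde (permₛ T id)
      ≡⟨ cong (moveSign T g *_) vandermonde-id ⟩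
    moveSign T g * 1ℤ
      ≡⟨ ℤ.*-identityʳ (moveSign T g) ⟩
    moveSign T g ∎)

  sgn-run : ∀ w → sgn (permₛ T (run w)) ≡ wordSign T w
  sgn-run w = trans (sgn≡vandermonde (permₛ T (run w)) nonzero) (vandermonde-run w)
    where
    0≢1 : 0ℤ ≢ 1ℤ
    0≢1 ()
    nonzero : vandermonde (permₛ T (run w)) ≢ 0ℤ
    nonzero v≡0 = 0≢1 (trans (cong (λ t → t * t) (trans (sym v≡0) (vandermonde-run w))) (wordSign² w))

module _ {S T : List (Sym3 m)} (oS : Orbit S) (oT : Orbit T) where

  sgn-run-cong : (∀ g → moveSign S g ≡ moveSign T g) →
    ∀ w → sgn (permₛ S (run w)) ≡ sgn (permₛ T (run w))
  sgn-run-cong e w = trans (sgn-run oS w) (trans (cong prodℤ (map-cong e w)) (sym (sgn-run oT w)))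

module _ {S T₁ T₂ : List (Sym3 m)} (oS : Orbit S) (o₁ : Orbit T₁) (o₂ : Orbit T₂) where

  sgn-run-* : (∀ g → moveSign S g ≡ moveSign T₁ g * moveSign T₂ g) →
    ∀ w → sgn (permₛ S (run w)) ≡ sgn (permₛ T₁ (run w)) * sgn (permₛ T₂ (run w))
  sgn-run-* e w = begin
    sgn (permₛ S (run w))
      ≡⟨ sgn-run oS w ⟩
    wordSign S w
      ≡⟨ cong prodℤ (map-cong e w) ⟩
    prodℤ (map (λ g → moveSign T₁ g * moveSign T₂ g) w)
      ≡⟨ prodℤ-map-* (moveSign T₁) (moveSign T₂) w ⟨
    wordSign T₁ w * wordSign T₂ w
      ≡⟨ cong₂ _*_ (sgn-run o₁ w) (sgn-run o₂ w) ⟨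
    sgn (permₛ T₁ (run w)) * sgn (permₛ T₂ (run w)) ∎
    where open ≡-Reasoning

module _ {S T₁ T₂ T₃ : List (Sym3 m)} (oS : Orbit S) (o₁ : Orbit T₁) (o₂ : Orbit T₂) (o₃ : Orbit T₃) where

  sgn-run-*-* : (∀ g → moveSign S g ≡ moveSign T₁ g * moveSign T₂ g * moveSign T₃ g) →
    ∀ w → sgn (permₛ S (run w))
        ≡ sgn (permₛ T₁ (run w)) * sgn (permₛ T₂ (run w)) * sgn (permₛ T₃ (run w))
  sgn-run-*-* e w = begin
    sgn (permₛ S (run w))
      ≡⟨ sgn-run oS w ⟩
    wordSign S w
      ≡⟨ cong prodℤ (map-cong e w) ⟩
    prodℤ (map (λ g → moveSign T₁ g * moveSign T₂ g * moveSign T₃ g) w)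
      ≡⟨ prodℤ-map-* (λ g → moveSign T₁ g * moveSign T₂ g) (moveSign T₃) w ⟨
    prodℤ (map (λ g → moveSign T₁ g * moveSign T₂ g) w) * wordSign T₃ w
      ≡⟨ cong (_* wordSign T₃ w) (prodℤ-map-* (moveSign T₁) (moveSign T₂) w) ⟨
    wordSign T₁ w * wordSign T₂ w * wordSign T₃ w
      ≡⟨ cong₂ _*_ (cong₂ _*_ (sgn-run o₁ w) (sgn-run o₂ w)) (sgn-run o₃ w) ⟨
    sgn (permₛ T₁ (run w)) * sgn (permₛ T₂ (run w)) * sgn (permₛ T₃ (run w)) ∎
    where open ≡-Reasoning

-- Orientation sums along words of moves

memberₛ : Sym3 m → List (Sym3 m) → Bool
memberₛ p [] = false
memberₛ p (q ∷ qs) = if does (p ≟ₛ₃ q) then true else memberₛ p qs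

-- The default `c` is never reached on the cubies of the tracked orbit, each of which carries a
-- tracker.
trackerAt : List (Sym3 m) → Sym3 m → Sym3 m
trackerAt [] c = c
trackerAt (q ∷ qs) c = if does (clampₛ₃ q ≟ₛ₃ c) then q else trackerAt qs c

-- Tr tracks one facelet of each cubie.  If a move changes the orientation of
-- a sticker by an amount depending only on the cubie it lies on, and these
-- amounts sum to 0, then the sum of all orientations is invariant.
record Orientation (r : ℕ) .{{_ : NonZero r}} (O : Sym3 m → ℕ) (Tr Fs : List (Sym3 m)) : Set where
  -- In the instances below a tracker in its home place has orientation 0, so its orientation after
  -- `g` is the change that `g` makes on its cubie.
  shift : Move m → Sym3 m → ℕ
  shift g c = O (act g (trackerAt Tr c))
  cubies = map clampₛ₃ Tr
  field
    stable-facelets : Stable Fs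
    stable-cubies : Stable cubies
    Tr⊆Fs : All (_∈ Fs) Tr
    local : ∀ g → All (λ p → O (act g p) % r ≡ (O p ℕ.+ shift g (clampₛ₃ p)) % r) Fs
    total : ∀ g → sum (map (shift g) cubies) % r ≡ 0
    initial : sum (map O Tr) % r ≡ 0

  sum-run : ∀ w → sum (map (O ∘ run w) Tr) % r ≡ 0
  sum-run [] = initial
  sum-run (g ∷ w) = begin
    sum (map (O ∘ act g ∘ run w) Tr) % r
      ≡⟨ sum-map-cong-% r _ (O ∘ run w) (shift g ∘ run w ∘ clampₛ₃) (All.map step Tr⊆Fs) ⟩
    (sum (map (O ∘ run w) Tr) ℕ.+ sum (map (shift g ∘ run w ∘ clampₛ₃) Tr)) % r
      ≡⟨ %-distribˡ-+ (sum (map (O ∘ run w) Tr)) _ r ⟩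
    (sum (map (O ∘ run w) Tr) % r ℕ.+ sum (map (shift g ∘ run w ∘ clampₛ₃) Tr) % r) % r
      ≡⟨ cong₂ (λ s t → (s ℕ.+ t) % r) (sum-run w) shift-total ⟩
    0 % r
      ≡⟨ 0% r ⟩
    0 ∎
    where
    open ≡-Reasoning
    0% : ∀ k .{{_ : NonZero k}} → 0 % k ≡ 0
    0% (suc _) = refl
    step : ∀ {p} → p ∈ Fs →
      O (act g (run w p)) % r ≡ (O (run w p) ℕ.+ shift g (run w (clampₛ₃ p))) % r
    step {p} p∈Fs = trans (All.lookup (local g) (run-∈ stable-facelets w p∈Fs))
      (cong (λ c → (O (run w p) ℕ.+ shift g c) % r) (sym (run-clampₛ₃ w p)))
    -- `run w` permutes the cubies, so the shifts at the cubies currently occupied are the shifts at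
    -- all cubies in another order.
    shift-total : sum (map (shift g ∘ run w ∘ clampₛ₃) Tr) % r ≡ 0
    shift-total = begin
      sum (map (shift g ∘ run w ∘ clampₛ₃) Tr) % r
        ≡⟨ cong (λ l → sum l % r) (trans (map-∘ Tr) (map-∘ cubies)) ⟩
      sum (map (shift g) (map (run w) cubies)) % r
        ≡⟨ cong (_% r) (sum-↭ (map⁺ (shift g) (run-↭ stable-cubies w))) ⟩
      sum (map (shift g) cubies) % r
        ≡⟨ total g ⟩
      0 ∎

-- The orbits and their signs

cornersBy : ∀ {X : Set} → X → X → List (X × X × X)
cornersBy h l = (h , h , h) ∷ (h , h , l) ∷ (h , l , h) ∷ (h , l , l)
              ∷ (l , h , h) ∷ (l , h , l) ∷ (l , l , h) ∷ (l , l , l) ∷ []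

-- Each edge cubie as its two facelets; h and l are the extreme cubie
-- coordinates along an axis and H and K the face coordinates next to them.
edgesBy : ∀ {X : Set} → X → X → X → X → X → Vec ((X × X × X) × (X × X × X)) 12
edgesBy t h l H K =
    ((t , H , h) , (t , h , H)) ∷ ((t , H , l) , (t , h , K))
  ∷ ((t , K , h) , (t , l , H)) ∷ ((t , K , l) , (t , l , K))
  ∷ ((H , t , h) , (h , t , H)) ∷ ((H , t , l) , (h , t , K))
  ∷ ((K , t , h) , (l , t , H)) ∷ ((K , t , l) , (l , t , K))
  ∷ ((H , h , t) , (h , H , t)) ∷ ((H , l , t) , (h , K , t))
  ∷ ((K , h , t) , (l , H , t)) ∷ ((K , l , t) , (l , K , t)) ∷ []

cornersₛ : List (Sym3 m)
cornersₛ = cornersBy (pos (suc zero)) (neg (suc zero))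

edgesₛ : Sym m → Vec (Sym3 m × Sym3 m) 12
edgesₛ t = edgesBy t (pos (suc zero)) (neg (suc zero)) (pos zero) (neg zero)

coupledₛ : Sym m → List (Sym3 m × Sym3 m)
coupledₛ t = Vec.toList (edgesₛ t) ++ Vec.toList (edgesₛ (negₛ t))

edgeCubies : List (Sym3 m × Sym3 m) → List (Sym3 m)
edgeCubies = map (clampₛ₃ ∘ proj₁)

singleCubies : List (Sym3 0)
singleCubies = edgeCubies (Vec.toList (edgesₛ mid))

coupledCubies : Sym m → List (Sym3 m)
coupledCubies t = edgeCubies (coupledₛ t)

faceletₛ : Face → Sym m → Sym m → Sym3 m
faceletₛ R r c = pos zero , negₛ r , negₛ c
faceletₛ L r c = neg zero , negₛ r , c
faceletₛ U r c = c , pos zero , r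
faceletₛ D r c = c , neg zero , negₛ r
faceletₛ F r c = c , negₛ r , pos zero
faceletₛ B r c = negₛ c , negₛ r , neg zero

centerEdgesₛ : Sym m → Sym m → List (Sym3 m)
centerEdgesₛ a b = concatMap (λ f → faceletₛ f a b ∷ faceletₛ f b (negₛ a)
  ∷ faceletₛ f (negₛ a) (negₛ b) ∷ faceletₛ f (negₛ b) a ∷ []) faces

centerCornersₛ : Sym m → List (Sym3 m)
centerCornersₛ a = concatMap (λ f → faceletₛ f a a ∷ faceletₛ f a (negₛ a)
  ∷ faceletₛ f (negₛ a) (negₛ a) ∷ faceletₛ f (negₛ a) a ∷ []) faces

-- Rows 1 ≤ r ≤ n / 2 have negative coordinate.
row₁ : Sym (suc m)
row₁ = neg (suc (suc zero))

row₂ : Sym (suc (suc m))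
row₂ = neg (suc (suc (suc zero)))

-- The corners recur in every alphabet because signs are compared along one word of moves, and words
-- belong to an alphabet.
corners₀ : List (Sym3 0)
corners₀ = cornersₛ

corners₁ coupled₁ centerCorners₁ centerEdges₁ : List (Sym3 1)
corners₁ = cornersₛ
coupled₁ = coupledCubies row₁
centerCorners₁ = centerCornersₛ row₁
centerEdges₁ = centerEdgesₛ row₁ mid

corners₂ coupled₂ coupled₂′ centerEdges₂ : List (Sym3 2)
corners₂ = cornersₛ
coupled₂ = coupledCubies row₁
coupled₂′ = coupledCubies row₂
centerEdges₂ = centerEdgesₛ row₁ row₂

-- A face turn is a 4-cycle on the corners and a 4-cycle on the single edges; inner slices move
-- neither.
sgn-single : ∀ w → sgn (permₛ corners₀ (run w)) ≡ sgn (permₛ singleCubies (run w))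
sgn-single = sgn-run-cong {S = corners₀} {T = singleCubies}
  (checkOrbit corners₀ refl refl refl) (checkOrbit singleCubies refl refl refl)
  (forMoves (λ g → moveSign corners₀ g ℤ.≟ moveSign singleCubies g) refl)

-- A face turn is one 4-cycle on the center corners, as on the corners. The slice through the row
-- gives two 4-cycles of center corners, hence an even permutation, and fixes the corners.
sgn-centerCorners : ∀ w → sgn (permₛ corners₁ (run w)) ≡ sgn (permₛ centerCorners₁ (run w))
sgn-centerCorners = sgn-run-cong {S = corners₁} {T = centerCorners₁}
  (checkOrbit corners₁ refl refl refl) (checkOrbit centerCorners₁ refl refl refl)
  (forMoves (λ g → moveSign corners₁ g ℤ.≟ moveSign centerCorners₁ g) refl)

-- A face turn is a 4-cycle on center edges and corners but two 4-cycles on coupled edges; the inner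
-- slice is a 4-cycle on center edges and coupled edges and fixes the corners.
sgn-centerEdges-mid : ∀ w → sgn (permₛ centerEdges₁ (run w))
  ≡ sgn (permₛ corners₁ (run w)) * sgn (permₛ coupled₁ (run w))
sgn-centerEdges-mid = sgn-run-* {S = centerEdges₁} {T₁ = corners₁} {T₂ = coupled₁}
  (checkOrbit centerEdges₁ refl refl refl) (checkOrbit corners₁ refl refl refl)
  (checkOrbit coupled₁ refl refl refl)
  (forMoves (λ g → moveSign centerEdges₁ g ℤ.≟ moveSign corners₁ g * moveSign coupled₁ g) refl)

-- A face turn is odd on center edges and corners only. Each of the two inner slices is a 4-cycle on
-- the center edges and on the coupled edges of its own row, and fixes the other two orbits.
sgn-centerEdges : ∀ w → sgn (permₛ centerEdges₂ (run w))
  ≡ sgn (permₛ corners₂ (run w)) * sgn (permₛ coupled₂ (run w)) * sgn (permₛ coupled₂′ (run w))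
sgn-centerEdges = sgn-run-*-* {S = centerEdges₂} {T₁ = corners₂} {T₂ = coupled₂} {T₃ = coupled₂′}
  (checkOrbit centerEdges₂ refl refl refl) (checkOrbit corners₂ refl refl refl)
  (checkOrbit coupled₂ refl refl refl) (checkOrbit coupled₂′ refl refl refl)
  (forMoves (λ g → moveSign centerEdges₂ g
                     ℤ.≟ moveSign corners₂ g * moveSign coupled₂ g * moveSign coupled₂′ g) refl)

-- Orientations

checkOrientation : ∀ (r : ℕ) .{{_ : NonZero r}} (O : Sym3 m → ℕ) (Tr Fs : List (Sym3 m)) →
  does (All.all? (λ g → Bool.T? (is-just (stable? Fs g))) (allMoves m)) ≡ true →
  does (All.all? (λ g → Bool.T? (is-just (stable? (map clampₛ₃ Tr) g))) (allMoves m)) ≡ true →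
  does (All.all? (λ p → _∈?_ _≟ₛ₃_ p Fs) Tr) ≡ true →
  does (All.all? (λ g → All.all? (λ p → O (act g p) % r
    ℕ.≟ (O p ℕ.+ O (act g (trackerAt Tr (clampₛ₃ p)))) % r) Fs) (allMoves m)) ≡ true →
  does (All.all? (λ g → sum (map (λ c → O (act g (trackerAt Tr c))) (map clampₛ₃ Tr)) % r ℕ.≟ 0)
    (allMoves m)) ≡ true →
  sum (map O Tr) % r ≡ 0 →
  Orientation r O Tr Fs
checkOrientation r O Tr Fs stF stC sub loc tot ini = record
  { stable-facelets = checkStable Fs stF
  ; stable-cubies = checkStable (map clampₛ₃ Tr) stC
  ; Tr⊆Fs = decide (All.all? (λ p → _∈?_ _≟ₛ₃_ p Fs) Tr) sub
  ; local = forMoves (λ g → All.all? (λ p → O (act g p) % r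
      ℕ.≟ (O p ℕ.+ O (act g (trackerAt Tr (clampₛ₃ p)))) % r) Fs) loc
  ; total = forMoves
      (λ g → sum (map (λ c → O (act g (trackerAt Tr c))) (map clampₛ₃ Tr)) % r ℕ.≟ 0) tot
  ; initial = ini
  }

-- Corner twists

onFaceₛ : Sym m → Bool
onFaceₛ (pos zero) = true
onFaceₛ (neg zero) = true
onFaceₛ _ = false

axisₛ : Sym3 m → Fin 3
axisₛ (x , y , z) =
  if onFaceₛ x then zero else if onFaceₛ y then suc zero else suc (suc zero)

signₛ : Sym m → ℤ
signₛ (neg _) = -1ℤ
signₛ _ = 1ℤ

cwₛ : Sym3 m → Sym3 m
cwₛ p@(x , y , z) = pushOutₛ (clampₛ₃ p)
  (if does (signₛ (clampₛ x) * signₛ (clampₛ y) * signₛ (clampₛ z) ℤ.≟ 1ℤ)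
   then prevAx (axisₛ p) else nextAx (axisₛ p))

twist : Fin 3 → Sym3 m → ℕ
twist ax p = let f₀ = pushOutₛ (clampₛ₃ p) ax in
  if does (p ≟ₛ₃ f₀) then 0 else if does (p ≟ₛ₃ cwₛ f₀) then 1 else 2

cornerTrackers : Fin 3 → List (Sym3 0)
cornerTrackers ax = map (λ c → pushOutₛ c ax) corners₀

cornerFacelets : List (Sym3 0)
cornerFacelets = concatMap (λ c → map (pushOutₛ c) (allFin 3)) corners₀

-- A face turn about the axis `ax` twists nothing; about another axis it twists the four corners
-- alternately by 1 and 2, in total 6. The axis is split into cases so that each check is a closed
-- computation.
twistOrientation : ∀ ax → Orientation 3 (twist ax) (cornerTrackers ax) cornerFacelets
twistOrientation zero =
  checkOrientation 3 (twist zero) (cornerTrackers zero) cornerFacelets refl refl refl refl refl refl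
twistOrientation (suc zero) =
  checkOrientation 3 (twist (suc zero)) (cornerTrackers (suc zero)) cornerFacelets refl refl refl refl refl refl
twistOrientation (suc (suc zero)) =
  checkOrientation 3 (twist (suc (suc zero))) (cornerTrackers (suc (suc zero))) cornerFacelets
    refl refl refl refl refl refl

-- Single edge flips

Edge : Set
Edge = Sym3 0 × Sym3 0

singles : Vec Edge 12
singles = edgesₛ mid

singleFirsts singleSeconds : List (Sym3 0)
singleFirsts = map proj₁ (Vec.toList singles)
singleSeconds = map proj₂ (Vec.toList singles)

isSecond : Sym3 0 → Bool
isSecond p = memberₛ p singleSeconds

bit : Bool → ℕ
bit b = if b then 1 else 0

-- With the first facelets as reference, only turns of `U` and `D` flip edges, and they flip all
-- four that they move.
flipOrientation : Orientation 2 (bit ∘ isSecond) singleFirsts (singleFirsts ++ singleSeconds)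
flipOrientation =
  checkOrientation 2 (bit ∘ isSecond) singleFirsts (singleFirsts ++ singleSeconds) refl refl refl refl refl refl

chooseₛ : Bool → Edge → Sym3 0
chooseₛ false = proj₁
chooseₛ true = proj₂

referencesₛ : ∀ {k} → Vec Edge k → (Fin k → Bool) → List (Sym3 0)
referencesₛ es ref = Vec.toList (Vec.tabulate (λ i → chooseₛ (ref i) (Vec.lookup es i)))

-- Membership in the reference list as a Boolean formula: at a concrete facelet it evaluates
-- although `ref` is unknown, because each comparison guards its own occurrence of `ref`.
isReference : ∀ {k} → Vec Edge k → (Fin k → Bool) → Sym3 0 → Bool
isReference [] ref p = false
isReference ((e₁ , e₂) ∷ es) ref p =
  (does (p ≟ₛ₃ e₁) ∧ not (ref zero)) ∨ ((does (p ≟ₛ₃ e₂) ∧ ref zero) ∨ isReference es (ref ∘ suc) p)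

memberₛ-referencesₛ : ∀ {k} (es : Vec Edge k) ref p →
  memberₛ p (referencesₛ es ref) ≡ isReference es ref p
memberₛ-referencesₛ [] ref p = refl
memberₛ-referencesₛ ((e₁ , e₂) ∷ es) ref p with ref zero
... | false with does (p ≟ₛ₃ e₁) | does (p ≟ₛ₃ e₂)
...   | true  | _ = refl
...   | false | true = memberₛ-referencesₛ es (ref ∘ suc) p
...   | false | false = memberₛ-referencesₛ es (ref ∘ suc) p
memberₛ-referencesₛ ((e₁ , e₂) ∷ es) ref p | true with does (p ≟ₛ₃ e₁) | does (p ≟ₛ₃ e₂)
...   | true | true = refl
...   | false | true = refl
...   | false | false = memberₛ-referencesₛ es (ref ∘ suc) p
...   | true | false = memberₛ-referencesₛ es (ref ∘ suc) p

referenceAt : ∀ {k} → Vec Edge k → (Fin k → Bool) → Sym3 0 → Bool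
referenceAt [] ref c = false
referenceAt ((e₁ , e₂) ∷ es) ref c =
  if does (clampₛ₃ e₁ ≟ₛ₃ c) then ref zero else referenceAt es (ref ∘ suc) c

-- Both orders of the two facelets occur, because a turn may carry a first facelet to a second one.
orientedEdges : List Edge
orientedEdges = Vec.toList singles ++ map (λ (p , q) → q , p) (Vec.toList singles)


∈-singles : ∀ k → Vec.lookup singles k ∈ orientedEdges
∈-singles k = ∈-++⁺ˡ (∈-toList⁺ (∈-lookup k singles))

run-orientedEdges : ∀ w {p q} → (p , q) ∈ orientedEdges → (run w p , run w q) ∈ orientedEdges
run-orientedEdges [] e∈ = e∈
run-orientedEdges (g ∷ w) e∈ = All.lookup (step g) (run-orientedEdges w e∈)
  where
  step : ∀ g → All (λ (p , q) → (act g p , act g q) ∈ orientedEdges) orientedEdges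
  step = forMoves (λ g → All.all? (λ (p , q) →
    _∈?_ (×P.≡-dec _≟ₛ₃_ _≟ₛ₃_) (act g p , act g q) orientedEdges) orientedEdges) refl

other-facelet : All (λ (p , q) → (isSecond q ≡ not (isSecond p)) × (clampₛ₃ q ≡ clampₛ₃ p)) orientedEdges
other-facelet = decide (All.all? (λ (p , q) →
  (isSecond q Bool.≟ not (isSecond p)) ×-dec (clampₛ₃ q ≟ₛ₃ clampₛ₃ p)) orientedEdges) refl

swap-orientedEdges : ∀ {p q} → (p , q) ∈ orientedEdges → (q , p) ∈ orientedEdges
swap-orientedEdges = All.lookup {P = λ (p , q) → (q , p) ∈ orientedEdges}
  (decide (All.all? (λ (p , q) → _∈?_ (×P.≡-dec _≟ₛ₃_ _≟ₛ₃_) (q , p) orientedEdges) orientedEdges) refl)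

module SingleEdges (ref : Fin 12 → Bool) where

  private
    atCubie : Sym3 0 → Bool
    atCubie = referenceAt singles ref

    matches : Bool → Bool → Bool
    matches second c = if second then c else not c

    -- Here `b` is the choice at the home cubie, `s` tells whether the first facelet now lies in
    -- second place, and `c` is the choice at the current cubie.
    matches-% : ∀ b s c →
      (if matches (b xor s) c then 0 else 1) % 2 ≡ (bit b ℕ.+ bit s ℕ.+ bit c) % 2
    matches-% false false false = refl
    matches-% false false true = refl
    matches-% false true false = refl
    matches-% false true true = refl
    matches-% true false false = refl
    matches-% true false true = refl
    matches-% true true false = refl
    matches-% true true true = refl

  isReference-orientedEdges : All (λ (p , _) →
    isReference singles ref p ≡ matches (isSecond p) (atCubie (clampₛ₃ p))) orientedEdges
  isReference-orientedEdges =
      -- At each of the 24 facelets all disjuncts but one evaluate to `false`, leaving `ref k` or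
      -- its negation followed by `∨ false`.
      eq ∷ eq ∷ eq ∷ eq ∷ eq ∷ eq ∷ eq ∷ eq ∷ eq ∷ eq ∷ eq ∷ eq
    ∷ eq ∷ eq ∷ eq ∷ eq ∷ eq ∷ eq ∷ eq ∷ eq ∷ eq ∷ eq ∷ eq ∷ eq ∷ []
    where
    eq : ∀ {b} → b ∨ false ≡ b
    eq {b} = ∨-identityʳ b

  memberₛ-orientedEdges : ∀ {p q} → (p , q) ∈ orientedEdges →
    memberₛ p (referencesₛ singles ref) ≡ matches (isSecond p) (atCubie (clampₛ₃ p))
  memberₛ-orientedEdges {p} e∈ =
    trans (memberₛ-referencesₛ singles ref p) (All.lookup isReference-orientedEdges e∈)

  memberₛ-chooseₛ : ∀ b {p q} → (p , q) ∈ orientedEdges →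
    memberₛ (chooseₛ b (p , q)) (referencesₛ singles ref) ≡ matches (b xor isSecond p) (atCubie (clampₛ₃ p))
  memberₛ-chooseₛ false e∈ = memberₛ-orientedEdges e∈
  memberₛ-chooseₛ true e∈ = trans (memberₛ-orientedEdges (swap-orientedEdges e∈))
    (cong₂ (λ s c → matches s (atCubie c))
      (proj₁ (All.lookup other-facelet e∈)) (proj₂ (All.lookup other-facelet e∈)))

  flipₛ : (Sym3 0 → Sym3 0) → Fin 12 → ℕ
  flipₛ d k = if memberₛ (d (chooseₛ (ref k) (Vec.lookup singles k))) (referencesₛ singles ref) then 0 else 1

  -- Modulo 2 each flip is the flip for the first facelets plus the choices at the home cubie and at
  -- the current cubie. Summed over all edges, both kinds of choices give `refs`, which therefore
  -- counts twice.
  sum-flipₛ : ∀ w → sum (map (flipₛ (run w)) (allFin 12)) % 2 ≡ 0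
  sum-flipₛ w = begin
    sum (map (flipₛ (run w)) (allFin 12)) % 2
      ≡⟨ sum-map-cong-% 2 (flipₛ (run w)) (λ k → bit (ref k) ℕ.+ base k) at (All.universal step (allFin 12)) ⟩
    (sum (map (λ k → bit (ref k) ℕ.+ base k) (allFin 12)) ℕ.+ sum (map at (allFin 12))) % 2
      ≡⟨ cong₂ (λ s t → (s ℕ.+ t) % 2) (sum-map-+ (bit ∘ ref) base (allFin 12)) at-total ⟩
    (refs ℕ.+ sum (map base (allFin 12)) ℕ.+ refs) % 2
      ≡⟨ cong (_% 2) (collect refs (sum (map base (allFin 12)))) ⟩
    (sum (map base (allFin 12)) ℕ.+ refs ℕ.* 2) % 2
      ≡⟨ [m+kn]%n≡m%n (sum (map base (allFin 12))) refs 2 ⟩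
    sum (map base (allFin 12)) % 2
      ≡⟨ Orientation.sum-run flipOrientation w ⟩
    0 ∎
    where
    open ≡-Reasoning
    edge : Fin 12 → Edge
    edge = Vec.lookup singles
    base at : Fin 12 → ℕ
    base k = bit (isSecond (run w (proj₁ (edge k))))
    at k = bit (atCubie (run w (clampₛ₃ (proj₁ (edge k)))))
    refs : ℕ
    refs = sum (map (bit ∘ ref) (allFin 12))
    collect : ∀ s t → s ℕ.+ t ℕ.+ s ≡ t ℕ.+ s ℕ.* 2
    collect = solveℕ-∀
    run-chooseₛ : ∀ b e → run w (chooseₛ b e) ≡ chooseₛ b (run w (proj₁ e) , run w (proj₂ e))
    run-chooseₛ false _ = refl
    run-chooseₛ true _ = refl
    step : ∀ k → flipₛ (run w) k % 2 ≡ (bit (ref k) ℕ.+ base k ℕ.+ at k) % 2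
    step k = begin
      flipₛ (run w) k % 2
        ≡⟨ cong (λ p → (if memberₛ p (referencesₛ singles ref) then 0 else 1) % 2) (run-chooseₛ (ref k) (edge k)) ⟩
      (if memberₛ (chooseₛ (ref k) (run w (proj₁ (edge k)) , run w (proj₂ (edge k)))) (referencesₛ singles ref)
       then 0 else 1) % 2
        ≡⟨ cong (λ b → (if b then 0 else 1) % 2) (memberₛ-chooseₛ (ref k) (run-orientedEdges w (∈-singles k))) ⟩
      (if matches (ref k xor isSecond (run w (proj₁ (edge k)))) (atCubie (clampₛ₃ (run w (proj₁ (edge k)))))
       then 0 else 1) % 2
        ≡⟨ matches-% (ref k) (isSecond (run w (proj₁ (edge k)))) (atCubie (clampₛ₃ (run w (proj₁ (edge k))))) ⟩
      (bit (ref k) ℕ.+ base k ℕ.+ bit (atCubie (clampₛ₃ (run w (proj₁ (edge k)))))) % 2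
        ≡⟨ cong (λ c → (bit (ref k) ℕ.+ base k ℕ.+ bit (atCubie c)) % 2) (run-clampₛ₃ w (proj₁ (edge k))) ⟨
      (bit (ref k) ℕ.+ base k ℕ.+ at k) % 2 ∎
    -- Both sides unfold to sums of the choices over the cubies, after and before `run w` permutes
    -- them.
    at-total : sum (map at (allFin 12)) ≡ refs
    at-total = sum-↭ (map⁺ (bit ∘ atCubie) (run-↭ (Orientation.stable-cubies flipOrientation) w))

-- Handedness of coupled edge facelets

coupledFacelets : List (Sym3 1)
coupledFacelets = map proj₁ (coupledₛ row₁) ++ map proj₂ (coupledₛ row₁)

faceStepₛ cubieExtₛ : Sym m → ℤ
faceStepₛ (pos zero) = 1ℤ
faceStepₛ (neg zero) = -1ℤ
faceStepₛ _ = 0ℤ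
cubieExtₛ (pos (suc zero)) = 1ℤ
cubieExtₛ (neg (suc zero)) = -1ℤ
cubieExtₛ _ = 0ℤ

leftward : Sym3 m → P3
leftward (x , y , z) =
  let N = faceStepₛ x , faceStepₛ y , faceStepₛ z
      M = sub3 (cubieExtₛ (clampₛ x) , cubieExtₛ (clampₛ y) , cubieExtₛ (clampₛ z)) N
  in cross N M

normal : Face → P3
normal U = 0ℤ , 1ℤ , 0ℤ
normal D = 0ℤ , -1ℤ , 0ℤ
normal F = 0ℤ , 0ℤ , 1ℤ
normal B = 0ℤ , 0ℤ , -1ℤ
normal R = 1ℤ , 0ℤ , 0ℤ
normal L = -1ℤ , 0ℤ , 0ℤ

-- The default `U` does no harm: `normal-leftFace` confirms that on coupled edge facelets the face
-- found has the required normal.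
findFace : List Face → P3 → Face
findFace [] v = U
findFace (f ∷ fs) v = if does (normal f ≟₃ v) then f else findFace fs v

leftFace : Sym3 m → Face
leftFace p = findFace faces (leftward p)

positiveₛ : Sym m → Bool
positiveₛ (pos _) = true
positiveₛ _ = false

-- The leftward direction is the outward normal of a face, so the dot product with it is a depth
-- towards that face; its sign can be read off the letter without knowing `n`.
leftHandedₛ : Sym3 m → Bool
leftHandedₛ p = positiveₛ (depthₛ (leftFace p) (clampₛ₃ p))

leftOfₛ : Sym3 m × Sym3 m → Sym3 m
leftOfₛ (p , q) = if leftHandedₛ p then p else q

normal-leftFace : All (λ p → normal (leftFace p) ≡ leftward p) coupledFacelets
normal-leftFace = decide (All.all? (λ p → normal (leftFace p) ≟₃ leftward p) coupledFacelets) refl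

stable-coupledFacelets : Stable coupledFacelets
stable-coupledFacelets = checkStable coupledFacelets refl

LeftFacelet : Sym3 1 × Sym3 1 → Set
LeftFacelet pq =
  (proj₁ pq ∈ coupledFacelets) × (leftOfₛ pq ∈ coupledFacelets) × (leftHandedₛ (leftOfₛ pq) ≡ true)

leftFacelets : All LeftFacelet (coupledₛ row₁)
leftFacelets = decide (All.all? (λ pq → (_∈?_ _≟ₛ₃_ (proj₁ pq) coupledFacelets)
  ×-dec ((_∈?_ _≟ₛ₃_ (leftOfₛ pq) coupledFacelets) ×-dec (leftHandedₛ (leftOfₛ pq) Bool.≟ true))) (coupledₛ row₁)) refl

-- Rotations of space respect the cross product, so a turn cannot exchange left and right; on the 48
-- facelets this is verified move by move.
leftHandedₛ-run : ∀ w {p} → p ∈ coupledFacelets → leftHandedₛ (run w p) ≡ leftHandedₛ p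
leftHandedₛ-run [] p∈ = refl
leftHandedₛ-run (g ∷ w) p∈ =
  trans (All.lookup (step g) (run-∈ stable-coupledFacelets w p∈)) (leftHandedₛ-run w p∈)
  where
  step : ∀ g → All (λ p → leftHandedₛ (act g p) ≡ leftHandedₛ p) coupledFacelets
  step = forMoves (λ g → All.all? (λ p → leftHandedₛ (act g p) Bool.≟ leftHandedₛ p) coupledFacelets) refl

-- Interpretation of the letters as coordinates

private
  +≢- : ∀ {a b} → 1 ≤ b → + a ≢ - (+ b)
  +≢- {b = suc _} _ ()

  -≢+ : ∀ {a b} → 1 ≤ a → - (+ a) ≢ + b
  -≢+ {suc _} _ ()

  +<0 : ∀ {a} → ¬ + a ℤ.< 0ℤ
  +<0 (ℤ.+<+ ())

  -<0 : ∀ {a} → 1 ≤ a → - (+ a) ℤ.< 0ℤ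
  -<0 {suc _} _ = ℤ.-<+

∸1-< : ∀ {k} → 1 ≤ k → k ℕ.∸ 1 ℕ.< k
∸1-< {suc _} _ = ℕ.≤-refl

dot-normal : ∀ f v → dot (normal f) v ≡ depth f v
dot-normal U (x , y , z) = trans (ℤ.+-identityʳ _) (trans (ℤ.+-identityˡ _) (ℤ.*-identityˡ y))
dot-normal D (x , y , z) = trans (ℤ.+-identityʳ _) (trans (ℤ.+-identityˡ _) (ℤ.-1*i≡-i y))
dot-normal F (x , y , z) = trans (ℤ.+-identityˡ _) (ℤ.*-identityˡ z)
dot-normal B (x , y , z) = trans (ℤ.+-identityˡ _) (ℤ.-1*i≡-i z)
dot-normal R (x , y , z) = trans (ℤ.+-identityʳ _) (trans (ℤ.+-identityʳ _) (ℤ.*-identityˡ x))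
dot-normal L (x , y , z) = trans (ℤ.+-identityʳ _) (trans (ℤ.+-identityʳ _) (ℤ.-1*i≡-i x))

-- The hypotheses make all letters positive and distinct, so `⟦_⟧` is injective and every equality
-- test on coordinates can be performed on letters.
module Interpretation (n : ℕ) (2≤n : 2 ≤ n) {m : ℕ} (inner : Fin m → ℕ)
  (1≤inner : ∀ i → 1 ≤ inner i) (inner<n∸1 : ∀ i → inner i ℕ.< n ℕ.∸ 1)
  (inner-injective : ∀ {i j} → inner i ≡ inner j → i ≡ j) where

  private
    1≤n : 1 ≤ n
    1≤n = ℕ.<⇒≤ 2≤n

    1≤n∸1 : 1 ≤ n ℕ.∸ 1
    1≤n∸1 = ℕ.∸-monoˡ-≤ 1 2≤n

  letter : Fin (2 ℕ.+ m) → ℕ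
  letter zero = n
  letter (suc zero) = n ℕ.∸ 1
  letter (suc (suc i)) = inner i

  1≤letter : ∀ i → 1 ≤ letter i
  1≤letter zero = 1≤n
  1≤letter (suc zero) = 1≤n∸1
  1≤letter (suc (suc i)) = 1≤inner i

  letter<n : ∀ i → letter (suc i) ℕ.< n
  letter<n zero = ∸1-< 1≤n
  letter<n (suc i) = ℕ.<-≤-trans (inner<n∸1 i) (ℕ.m∸n≤m n 1)

  letter-injective : ∀ {i j} → letter i ≡ letter j → i ≡ j
  letter-injective {zero} {zero} _ = refl
  letter-injective {zero} {suc j} eq = contradiction (sym eq) (ℕ.<⇒≢ (letter<n j))
  letter-injective {suc i} {zero} eq = contradiction eq (ℕ.<⇒≢ (letter<n i))
  letter-injective {suc zero} {suc zero} _ = refl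
  letter-injective {suc zero} {suc (suc j)} eq = contradiction (sym eq) (ℕ.<⇒≢ (inner<n∸1 j))
  letter-injective {suc (suc i)} {suc zero} eq = contradiction eq (ℕ.<⇒≢ (inner<n∸1 i))
  letter-injective {suc (suc i)} {suc (suc j)} eq = cong (λ k → suc (suc k)) (inner-injective eq)

  ⟦_⟧ : Sym m → ℤ
  ⟦ mid ⟧ = 0ℤ
  ⟦ pos i ⟧ = + letter i
  ⟦ neg i ⟧ = - (+ letter i)

  ⟦_⟧₃ : Sym3 m → P3
  ⟦ x , y , z ⟧₃ = ⟦ x ⟧ , ⟦ y ⟧ , ⟦ z ⟧

  ⟦_⟧₃² : Sym3 m × Sym3 m → P3 × P3
  ⟦ p , q ⟧₃² = ⟦ p ⟧₃ , ⟦ q ⟧₃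

  ⟦⟧-injective : ∀ {s t} → ⟦ s ⟧ ≡ ⟦ t ⟧ → s ≡ t
  ⟦⟧-injective {mid} {mid} _ = refl
  ⟦⟧-injective {mid} {pos j} eq = contradiction (ℤ.+-injective eq) (ℕ.<⇒≢ (1≤letter j))
  ⟦⟧-injective {mid} {neg j} eq = contradiction eq (+≢- (1≤letter j))
  ⟦⟧-injective {pos i} {mid} eq = contradiction (sym (ℤ.+-injective eq)) (ℕ.<⇒≢ (1≤letter i))
  ⟦⟧-injective {pos i} {pos j} eq = cong pos (letter-injective (ℤ.+-injective eq))
  ⟦⟧-injective {pos i} {neg j} eq = contradiction eq (+≢- (1≤letter j))
  ⟦⟧-injective {neg i} {mid} eq = contradiction eq (-≢+ (1≤letter i))
  ⟦⟧-injective {neg i} {pos j} eq = contradiction eq (-≢+ (1≤letter i))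
  ⟦⟧-injective {neg i} {neg j} eq = cong neg (letter-injective (ℤ.+-injective (ℤ.neg-injective eq)))

  ⟦⟧₃-injective : ∀ {p q} → ⟦ p ⟧₃ ≡ ⟦ q ⟧₃ → p ≡ q
  ⟦⟧₃-injective eq = cong₂ _,_ (⟦⟧-injective (cong proj₁ eq))
    (cong₂ _,_ (⟦⟧-injective (cong (proj₁ ∘ proj₂) eq)) (⟦⟧-injective (cong (proj₂ ∘ proj₂) eq)))

  ≟-⟦⟧ : ∀ s t → does (⟦ s ⟧ ℤ.≟ ⟦ t ⟧) ≡ does (s ≟ₛ t)
  ≟-⟦⟧ s t = does-⇔ (mk⇔ ⟦⟧-injective (cong ⟦_⟧)) (⟦ s ⟧ ℤ.≟ ⟦ t ⟧) (s ≟ₛ t)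

  ≟-⟦⟧₃ : ∀ p q → (⟦ p ⟧₃ ==₃ ⟦ q ⟧₃) ≡ does (p ≟ₛ₃ q)
  ≟-⟦⟧₃ p q = does-⇔ (mk⇔ ⟦⟧₃-injective (cong ⟦_⟧₃)) (⟦ p ⟧₃ ≟₃ ⟦ q ⟧₃) (p ≟ₛ₃ q)

  -‿⟦⟧ : ∀ s → - ⟦ s ⟧ ≡ ⟦ negₛ s ⟧
  -‿⟦⟧ mid = refl
  -‿⟦⟧ (pos _) = refl
  -‿⟦⟧ (neg i) = ℤ.neg-involutive (+ letter i)

  clampZ-⟦⟧ : ∀ s → clampZ n ⟦ s ⟧ ≡ ⟦ clampₛ s ⟧
  clampZ-⟦⟧ mid
    rewrite dec-false (+ n ℤ.≤? + 0) (λ { (ℤ.+≤+ n≤0) → ℕ.<⇒≱ 1≤n n≤0 })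
          | dec-false (+ 0 ℤ.≤? - (+ n)) (λ 0≤-n → +<0 (ℤ.≤-<-trans 0≤-n (-<0 1≤n))) = refl
  clampZ-⟦⟧ (pos zero) rewrite dec-true (+ n ℤ.≤? + n) ℤ.≤-refl = refl
  clampZ-⟦⟧ (pos (suc i))
    rewrite dec-false (+ n ℤ.≤? + letter (suc i)) (λ { (ℤ.+≤+ n≤l) → ℕ.<⇒≱ (letter<n i) n≤l })
          | dec-false (+ letter (suc i) ℤ.≤? - (+ n)) (λ l≤-n → +<0 (ℤ.≤-<-trans l≤-n (-<0 1≤n))) = refl
  clampZ-⟦⟧ (neg zero)
    rewrite dec-false (+ n ℤ.≤? - (+ n)) (λ n≤-n → +<0 (ℤ.≤-<-trans n≤-n (-<0 1≤n)))
          | dec-true (- (+ n) ℤ.≤? - (+ n)) ℤ.≤-refl = refl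
  clampZ-⟦⟧ (neg (suc i))
    rewrite dec-false (+ n ℤ.≤? - (+ letter (suc i)))
              (λ n≤-l → +<0 (ℤ.≤-<-trans n≤-l (-<0 (1≤letter (suc i)))))
          | dec-false (- (+ letter (suc i)) ℤ.≤? - (+ n))
              (λ -l≤-n → ℕ.<⇒≱ (letter<n i) (ℤ.drop‿+≤+ (ℤ.neg-cancel-≤ -l≤-n))) = refl

  clamp-⟦⟧ : ∀ p → clamp n ⟦ p ⟧₃ ≡ ⟦ clampₛ₃ p ⟧₃
  clamp-⟦⟧ (x , y , z) = cong₂ _,_ (clampZ-⟦⟧ x) (cong₂ _,_ (clampZ-⟦⟧ y) (clampZ-⟦⟧ z))

  outZ-⟦⟧ : ∀ s → outZ n ⟦ s ⟧ ≡ ⟦ outₛ s ⟧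
  outZ-⟦⟧ mid = refl
  outZ-⟦⟧ (pos i) rewrite dec-false (+ letter i ℤ.<? + 0) +<0 = refl
  outZ-⟦⟧ (neg i) rewrite dec-true (- (+ letter i) ℤ.<? + 0) (-<0 (1≤letter i)) = refl

  pushOut-⟦⟧ : ∀ p ax → pushOut n ⟦ p ⟧₃ ax ≡ ⟦ pushOutₛ p ax ⟧₃
  pushOut-⟦⟧ (x , y , z) zero = cong (λ t → t , _ , _) (outZ-⟦⟧ x)
  pushOut-⟦⟧ (x , y , z) (suc zero) = cong (λ t → _ , t , _) (outZ-⟦⟧ y)
  pushOut-⟦⟧ (x , y , z) (suc (suc zero)) = cong (λ t → _ , _ , t) (outZ-⟦⟧ z)

  rot-⟦⟧ : ∀ f p → rot f ⟦ p ⟧₃ ≡ ⟦ rotₛ f p ⟧₃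
  rot-⟦⟧ R (x , y , z) = cong (λ t → _ , _ , t) (-‿⟦⟧ y)
  rot-⟦⟧ L (x , y , z) = cong (λ t → _ , t , _) (-‿⟦⟧ z)
  rot-⟦⟧ U (x , y , z) = cong (λ t → t , _ , _) (-‿⟦⟧ z)
  rot-⟦⟧ D (x , y , z) = cong (λ t → _ , _ , t) (-‿⟦⟧ x)
  rot-⟦⟧ F (x , y , z) = cong (λ t → _ , t , _) (-‿⟦⟧ x)
  rot-⟦⟧ B (x , y , z) = cong (λ t → t , _ , _) (-‿⟦⟧ y)

  depth-⟦⟧ : ∀ f p → depth f ⟦ p ⟧₃ ≡ ⟦ depthₛ f p ⟧
  depth-⟦⟧ R _ = refl
  depth-⟦⟧ L (x , _) = -‿⟦⟧ x
  depth-⟦⟧ U _ = refl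
  depth-⟦⟧ D (_ , y , _) = -‿⟦⟧ y
  depth-⟦⟧ F _ = refl
  depth-⟦⟧ B (_ , _ , z) = -‿⟦⟧ z

  -- Either `t` is the value of a letter other than letter 0, or no tracked cubie lies at depth `t`.
  -- In the latter case letter 0 serves, since no clamped coordinate equals it.
  slice : ∀ t → 1 ≤ t → ∃ λ q → ∀ s → does (⟦ clampₛ s ⟧ ℤ.≟ + t) ≡ does (clampₛ s ≟ₛ pos q)
  slice t 1≤t with any? (λ i → letter (suc i) ℕ.≟ t)
  ... | yes (i , refl) = suc i , λ s → ≟-⟦⟧ (clampₛ s) (pos (suc i))
  ... | no ∄i = zero , misses
    where
    misses : ∀ s → does (⟦ clampₛ s ⟧ ℤ.≟ + t) ≡ does (clampₛ s ≟ₛ pos zero)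
    misses mid = dec-false (0ℤ ℤ.≟ + t) (λ eq → ℕ.<⇒≢ 1≤t (ℤ.+-injective eq))
    misses (pos zero) = dec-false (+ (n ℕ.∸ 1) ℤ.≟ + t) (λ eq → ∄i (zero , ℤ.+-injective eq))
    misses (pos (suc i)) = dec-false (+ letter (suc i) ℤ.≟ + t) (λ eq → ∄i (i , ℤ.+-injective eq))
    misses (neg zero) = dec-false (- (+ (n ℕ.∸ 1)) ℤ.≟ + t) (-≢+ 1≤n∸1)
    misses (neg (suc i)) = dec-false (- (+ letter (suc i)) ℤ.≟ + t) (-≢+ (1≤letter (suc i)))

  -- The bound on `k` keeps the depth n + 1 - 2k at least 1, so the slice avoids the middle and the
  -- far side, and the integer difference agrees with truncated subtraction.
  move-⟦⟧ : ∀ f k → 2 ℕ.* k ≤ n → ∃ λ g → ∀ p → move n f k ⟦ p ⟧₃ ≡ ⟦ act g p ⟧₃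
  move-⟦⟧ f k 2k≤n with slice (suc n ℕ.∸ 2 ℕ.* k) (ℕ.m<n⇒0<n∸m (ℕ.s≤s 2k≤n))
  ... | q , slice-q = (f , q) , λ p → trans (cong (λ b → if b then rot f ⟦ p ⟧₃ else ⟦ p ⟧₃) (test p)) (branch p)
    where
    open ≡-Reasoning
    test : ∀ p → does (depth f (clamp n ⟦ p ⟧₃) ℤ.≟ (+ suc n ℤ.- + (2 ℕ.* k)))
               ≡ does (depthₛ f (clampₛ₃ p) ≟ₛ pos q)
    test p = begin
      does (depth f (clamp n ⟦ p ⟧₃) ℤ.≟ (+ suc n ℤ.- + (2 ℕ.* k)))
        ≡⟨ cong₂ (λ u v → does (u ℤ.≟ v))
             (trans (cong (depth f) (clamp-⟦⟧ p)) (trans (depth-⟦⟧ f (clampₛ₃ p)) (cong ⟦_⟧ (depthₛ-clampₛ₃ f p))))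
             (trans (ℤ.m-n≡m⊖n (suc n) (2 ℕ.* k)) (ℤ.⊖-≥ (ℕ.m≤n⇒m≤1+n 2k≤n))) ⟩
      does (⟦ clampₛ (depthₛ f p) ⟧ ℤ.≟ + (suc n ℕ.∸ 2 ℕ.* k))
        ≡⟨ slice-q (depthₛ f p) ⟩
      does (clampₛ (depthₛ f p) ≟ₛ pos q)
        ≡⟨ cong (λ s → does (s ≟ₛ pos q)) (depthₛ-clampₛ₃ f p) ⟨
      does (depthₛ f (clampₛ₃ p) ≟ₛ pos q) ∎
    branch : ∀ p → (if does (depthₛ f (clampₛ₃ p) ≟ₛ pos q) then rot f ⟦ p ⟧₃ else ⟦ p ⟧₃) ≡ ⟦ act (f , q) p ⟧₃
    branch p with does (depthₛ f (clampₛ₃ p) ≟ₛ pos q)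
    ... | true = rot-⟦⟧ f p
    ... | false = refl

  -- The word depends on the alphabet: turns of slices that miss all letters become trivial moves in
  -- it.
  valid-⟦⟧ : ∀ {d} → Valid n d → ∃ λ w → ∀ p → d ⟦ p ⟧₃ ≡ ⟦ run w p ⟧₃
  valid-⟦⟧ solved = [] , λ _ → refl
  valid-⟦⟧ (turn f k _ k≤n/2 v)
    with valid-⟦⟧ v | move-⟦⟧ f k (ℕ.≤-trans (ℕ.≤-reflexive (ℕ.*-comm 2 k))
                         (ℕ.≤-trans (ℕ.*-monoˡ-≤ 2 k≤n/2) (m/n*n≤m n 2)))
  ... | w , d≗ | g , move≗ = g ∷ w , λ p → trans (cong (move n f k) (d≗ p)) (move≗ (run w p))

  indexOf-⟦⟧ : ∀ T p → indexOf (map ⟦_⟧₃ T) ⟦ p ⟧₃ ≡ indexOfₛ T p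
  indexOf-⟦⟧ [] p = refl
  indexOf-⟦⟧ (q ∷ T) p rewrite ≟-⟦⟧₃ q p | indexOf-⟦⟧ T p = refl

  member-⟦⟧ : ∀ T p → member ⟦ p ⟧₃ (map ⟦_⟧₃ T) ≡ memberₛ p T
  member-⟦⟧ [] p = refl
  member-⟦⟧ (q ∷ T) p rewrite ≟-⟦⟧₃ p q | member-⟦⟧ T p = refl

  cornerCenters-⟦⟧ : cornerCenters n ≡ map ⟦_⟧₃ cornersₛ
  -- `cornerCenters n` unfolds to `cornersBy` at the products `1ℤ * E n` and `-1ℤ * E n`.
  cornerCenters-⟦⟧ = cong₂ cornersBy (ℤ.*-identityˡ (+ (n ℕ.∸ 1))) (ℤ.-1*i≡-i (+ (n ℕ.∸ 1)))

  edgesAt-⟦⟧ : ∀ t → edgesAt n ⟦ t ⟧ ≡ Vec.map ⟦_⟧₃² (edgesₛ t)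
  edgesAt-⟦⟧ t = trans
    (cong₂ (λ h l → edgesBy ⟦ t ⟧ h l (outZ n h) (outZ n l)) (ℤ.*-identityˡ (+ (n ℕ.∸ 1))) (ℤ.-1*i≡-i (+ (n ℕ.∸ 1))))
    (cong₂ (edgesBy ⟦ t ⟧ (+ (n ℕ.∸ 1)) (- (+ (n ℕ.∸ 1)))) (outZ-⟦⟧ (pos (suc zero))) (outZ-⟦⟧ (neg (suc zero))))

  coupledEdges-⟦⟧ : ∀ i a → co n i ≡ ⟦ a ⟧ → coupledEdges n i ≡ map ⟦_⟧₃² (coupledₛ a)
  coupledEdges-⟦⟧ i a co≡ = cong₂ (λ u v → Vec.toList u ++ Vec.toList v)
    (trans (cong (edgesAt n) co≡) (edgesAt-⟦⟧ a))
    (trans (cong (edgesAt n) (trans (cong -_ co≡) (-‿⟦⟧ a))) (edgesAt-⟦⟧ (negₛ a)))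

  facelet-⟦⟧ : ∀ f r c a b → co n r ≡ ⟦ a ⟧ → co n c ≡ ⟦ b ⟧ → facelet n f r c ≡ ⟦ faceletₛ f a b ⟧₃
  facelet-⟦⟧ f r c a b er ec with f
  ... | R rewrite er | ec | -‿⟦⟧ a | -‿⟦⟧ b = refl
  ... | L rewrite er | ec | -‿⟦⟧ a = refl
  ... | U rewrite er | ec = refl
  ... | D rewrite er | ec | -‿⟦⟧ a = refl
  ... | F rewrite er | ec | -‿⟦⟧ a = refl
  ... | B rewrite er | ec | -‿⟦⟧ a | -‿⟦⟧ b = refl

  centerEdgeOrbit-⟦⟧ : ∀ i j a b → co n i ≡ ⟦ a ⟧ → co n (suc n ℕ.∸ i) ≡ ⟦ negₛ a ⟧ →
    co n j ≡ ⟦ b ⟧ → co n (suc n ℕ.∸ j) ≡ ⟦ negₛ b ⟧ →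
    centerEdgeOrbit n i j ≡ map ⟦_⟧₃ (centerEdgesₛ a b)
  centerEdgeOrbit-⟦⟧ i j a b a≡ a′≡ b≡ b′≡ = concatMap-cong (λ f →
    cong₂ _∷_ (facelet-⟦⟧ f i j a b a≡ b≡)
    (cong₂ _∷_ (facelet-⟦⟧ f j (suc n ℕ.∸ i) b (negₛ a) b≡ a′≡)
    (cong₂ _∷_ (facelet-⟦⟧ f (suc n ℕ.∸ i) (suc n ℕ.∸ j) (negₛ a) (negₛ b) a′≡ b′≡)
    (cong (_∷ []) (facelet-⟦⟧ f (suc n ℕ.∸ j) i (negₛ b) a b′≡ a≡))))) faces

  centerCornerOrbit-⟦⟧ : ∀ i a → co n i ≡ ⟦ a ⟧ → co n (suc n ℕ.∸ i) ≡ ⟦ negₛ a ⟧ →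
    centerCornerOrbit n i ≡ map ⟦_⟧₃ (centerCornersₛ a)
  centerCornerOrbit-⟦⟧ i a a≡ a′≡ = concatMap-cong (λ f →
    cong₂ _∷_ (facelet-⟦⟧ f i i a a a≡ a≡)
    (cong₂ _∷_ (facelet-⟦⟧ f i (suc n ℕ.∸ i) a (negₛ a) a≡ a′≡)
    (cong₂ _∷_ (facelet-⟦⟧ f (suc n ℕ.∸ i) (suc n ℕ.∸ i) (negₛ a) (negₛ a) a′≡ a′≡)
    (cong (_∷ []) (facelet-⟦⟧ f (suc n ℕ.∸ i) i (negₛ a) a a′≡ a≡))))) faces

  module _ {d : P3 → P3} {w : List (Move m)} (d≗ : ∀ p → d ⟦ p ⟧₃ ≡ ⟦ run w p ⟧₃) where

    -- Trackers are facelets while targets may be cubies. As `run w` commutes with `atₛ`, following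
    -- a facelet and then taking its cubie amounts to following the cubie.
    permOf-⟦⟧ : ∀ {targets trackers} {T Tr : List (Sym3 m)} at (atₛ : Sym3 m → Sym3 m) →
      (∀ p → at ⟦ p ⟧₃ ≡ ⟦ atₛ p ⟧₃) → (∀ p → run w (atₛ p) ≡ atₛ (run w p)) →
      targets ≡ map ⟦_⟧₃ T → trackers ≡ map ⟦_⟧₃ Tr → map atₛ Tr ≡ T →
      permOf d targets trackers at ≡ permₛ T (run w)
    permOf-⟦⟧ {T = T} {Tr} at atₛ at≗ commute refl refl atₛTr≡T = begin
      map (λ q → indexOf (map ⟦_⟧₃ T) (at (d q))) (map ⟦_⟧₃ Tr)
        ≡⟨ map-∘ Tr ⟨
      map (λ q → indexOf (map ⟦_⟧₃ T) (at (d ⟦ q ⟧₃))) Tr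
        ≡⟨ map-cong (λ q → trans
             (cong (indexOf (map ⟦_⟧₃ T))
               (trans (cong at (d≗ q)) (trans (at≗ (run w q)) (cong ⟦_⟧₃ (sym (commute q))))))
             (indexOf-⟦⟧ T (run w (atₛ q)))) Tr ⟩
      map (indexOfₛ T ∘ run w ∘ atₛ) Tr
        ≡⟨ map-∘ Tr ⟩
      map (indexOfₛ T ∘ run w) (map atₛ Tr)
        ≡⟨ cong (map (indexOfₛ T ∘ run w)) atₛTr≡T ⟩
      permₛ T (run w) ∎
      where open ≡-Reasoning

    σ-⟦⟧ : ∀ T → cornersₛ ≡ T → σ n d ≡ permₛ T (run w)
    σ-⟦⟧ _ refl = permOf-⟦⟧ {Tr = map (λ c → pushOutₛ c zero) cornersₛ} (clamp n) clampₛ₃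
      clamp-⟦⟧ (run-clampₛ₃ w) cornerCenters-⟦⟧
      (trans (cong (map (λ c → pushOut n c zero)) cornerCenters-⟦⟧)
             (map-cong (λ c → pushOut-⟦⟧ c zero) cornersₛ)) refl

    edges-⟦⟧ : ∀ es (esₛ : List (Sym3 m × Sym3 m)) → es ≡ map ⟦_⟧₃² esₛ →
      permOf d (map (clamp n ∘ proj₁) es) (map proj₁ es) (clamp n) ≡ permₛ (edgeCubies esₛ) (run w)
    edges-⟦⟧ _ esₛ refl = permOf-⟦⟧ {Tr = map proj₁ esₛ} (clamp n) clampₛ₃ clamp-⟦⟧ (run-clampₛ₃ w)
      (trans (sym (map-∘ esₛ)) (trans (map-cong (clamp-⟦⟧ ∘ proj₁) esₛ) (map-∘ esₛ)))
      (trans (sym (map-∘ esₛ)) (map-∘ esₛ)) (sym (map-∘ esₛ))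

    τs-⟦⟧ : ∀ T → edgeCubies (Vec.toList (edgesₛ mid)) ≡ T → τs n d ≡ permₛ T (run w)
    τs-⟦⟧ _ refl = edges-⟦⟧ (Vec.toList (singleEdges n)) (Vec.toList (edgesₛ mid)) (cong Vec.toList (edgesAt-⟦⟧ mid))

    τc-⟦⟧ : ∀ i a T → coupledCubies a ≡ T → co n i ≡ ⟦ a ⟧ → τc n i d ≡ permₛ T (run w)
    τc-⟦⟧ i a _ refl co≡ = edges-⟦⟧ (coupledEdges n i) (coupledₛ a) (coupledEdges-⟦⟧ i a co≡)

    ρ-⟦⟧ : ∀ targets T → targets ≡ map ⟦_⟧₃ T → permOf d targets targets id ≡ permₛ T (run w)
    ρ-⟦⟧ _ T eq = permOf-⟦⟧ {Tr = T} id id (λ _ → refl) (λ _ → refl) eq eq (map-id T)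

    ρc-⟦⟧ : ∀ i a T → centerCornersₛ a ≡ T → co n i ≡ ⟦ a ⟧ → co n (suc n ℕ.∸ i) ≡ ⟦ negₛ a ⟧ →
      ρc n i d ≡ permₛ T (run w)
    ρc-⟦⟧ i a T refl a≡ a′≡ = ρ-⟦⟧ (centerCornerOrbit n i) T (centerCornerOrbit-⟦⟧ i a a≡ a′≡)

    ρe-⟦⟧ : ∀ i j a b T → centerEdgesₛ a b ≡ T → co n i ≡ ⟦ a ⟧ → co n (suc n ℕ.∸ i) ≡ ⟦ negₛ a ⟧ →
      co n j ≡ ⟦ b ⟧ → co n (suc n ℕ.∸ j) ≡ ⟦ negₛ b ⟧ → ρe n i j d ≡ permₛ T (run w)
    ρe-⟦⟧ i j a b T refl a≡ a′≡ b≡ b′≡ =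
      ρ-⟦⟧ (centerEdgeOrbit n i j) T (centerEdgeOrbit-⟦⟧ i j a b a≡ a′≡ b≡ b′≡)

  sgnZ-⟦⟧ : ∀ s → sgnZ ⟦ s ⟧ ≡ signₛ s
  sgnZ-⟦⟧ mid = refl
  sgnZ-⟦⟧ (pos i) rewrite dec-false (+ letter i ℤ.<? + 0) +<0 = refl
  sgnZ-⟦⟧ (neg i) rewrite dec-true (- (+ letter i) ℤ.<? + 0) (-<0 (1≤letter i)) = refl

  onFace-⟦⟧ : ∀ s → (ℤ.∣ ⟦ s ⟧ ∣ ℕ.≡ᵇ n) ≡ onFaceₛ s
  onFace-⟦⟧ mid = dec-false (0 ℕ.≟ n) (ℕ.<⇒≢ 1≤n)
  onFace-⟦⟧ (pos zero) = dec-true (n ℕ.≟ n) refl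
  onFace-⟦⟧ (pos (suc i)) = dec-false (letter (suc i) ℕ.≟ n) (ℕ.<⇒≢ (letter<n i))
  onFace-⟦⟧ (neg zero) rewrite ℤ.∣-i∣≡∣i∣ (+ n) = dec-true (n ℕ.≟ n) refl
  onFace-⟦⟧ (neg (suc i)) rewrite ℤ.∣-i∣≡∣i∣ (+ letter (suc i)) =
    dec-false (letter (suc i) ℕ.≟ n) (ℕ.<⇒≢ (letter<n i))

  axisOf-⟦⟧ : ∀ p → axisOf n ⟦ p ⟧₃ ≡ axisₛ p
  axisOf-⟦⟧ (x , y , z) rewrite onFace-⟦⟧ x | onFace-⟦⟧ y = refl

  cw-⟦⟧ : ∀ p → cw n ⟦ p ⟧₃ ≡ ⟦ cwₛ p ⟧₃
  cw-⟦⟧ p@(x , y , z)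
    rewrite axisOf-⟦⟧ p | clampZ-⟦⟧ x | clampZ-⟦⟧ y | clampZ-⟦⟧ z
          | sgnZ-⟦⟧ (clampₛ x) | sgnZ-⟦⟧ (clampₛ y) | sgnZ-⟦⟧ (clampₛ z) =
    pushOut-⟦⟧ (clampₛ₃ p) _

  twist-⟦⟧ : ∀ ax p → let f₀ = pushOut n (clamp n ⟦ p ⟧₃) ax in
    (if ⟦ p ⟧₃ ==₃ f₀ then 0 else if ⟦ p ⟧₃ ==₃ cw n f₀ then 1 else 2) ≡ twist ax p
  twist-⟦⟧ ax p = trans
    (cong (λ f₀ → if ⟦ p ⟧₃ ==₃ f₀ then 0 else if ⟦ p ⟧₃ ==₃ cw n f₀ then 1 else 2)
      (trans (cong (λ c → pushOut n c ax) (clamp-⟦⟧ p)) (pushOut-⟦⟧ (clampₛ₃ p) ax)))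
    (trans
      (cong (λ f₁ → if ⟦ p ⟧₃ ==₃ ⟦ f₀ ⟧₃ then 0 else if ⟦ p ⟧₃ ==₃ f₁ then 1 else 2) (cw-⟦⟧ f₀))
      (cong₂ (λ b c → if b then 0 else if c then 1 else 2) (≟-⟦⟧₃ p f₀) (≟-⟦⟧₃ p (cwₛ f₀))))
    where
    f₀ : Sym3 m
    f₀ = pushOutₛ (clampₛ₃ p) ax

  faceStep-⟦⟧ : ∀ s → ⟦ s ⟧ ℤ.- clampZ n ⟦ s ⟧ ≡ faceStepₛ s
  faceStep-⟦⟧ s = trans (cong (λ t → ⟦ s ⟧ ℤ.- t) (clampZ-⟦⟧ s)) (step s)
    where
    up : ∀ {k} → 1 ≤ k → + k ℤ.- + (k ℕ.∸ 1) ≡ 1ℤ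
    up {suc k} _ = identity (+ k)
      where
      identity : ∀ x → (1ℤ ℤ.+ x) ℤ.- x ≡ 1ℤ
      identity = solve-∀
    down : ∀ {k} → 1 ≤ k → - (+ k) ℤ.- (- (+ (k ℕ.∸ 1))) ≡ -1ℤ
    down {suc k} _ = identity (+ k)
      where
      identity : ∀ x → - (1ℤ ℤ.+ x) ℤ.- (- x) ≡ -1ℤ
      identity = solve-∀
    step : ∀ s → ⟦ s ⟧ ℤ.- ⟦ clampₛ s ⟧ ≡ faceStepₛ s
    step mid = refl
    step (pos zero) = up 1≤n
    step (pos (suc i)) = ℤ.+-inverseʳ (+ letter (suc i))
    step (neg zero) = down 1≤n
    step (neg (suc i)) = ℤ.+-inverseʳ (- (+ letter (suc i)))

  extZ-⟦⟧ : ∀ s → extZ n ⟦ s ⟧ ≡ cubieExtₛ s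
  extZ-⟦⟧ s rewrite ≟-⟦⟧ s (pos (suc zero)) | ≟-⟦⟧ s (neg (suc zero)) = cases s
    where
    cases : ∀ s → (if does (s ≟ₛ pos (suc zero)) then 1ℤ else if does (s ≟ₛ neg (suc zero)) then -1ℤ else 0ℤ)
                ≡ cubieExtₛ s
    cases mid = refl
    cases (pos zero) = refl
    cases (pos (suc zero)) = refl
    cases (pos (suc (suc _))) = refl
    cases (neg zero) = refl
    cases (neg (suc zero)) = refl
    cases (neg (suc (suc _))) = refl

  positive-⟦⟧ : ∀ s → does (+ 0 ℤ.<? ⟦ s ⟧) ≡ positiveₛ s
  positive-⟦⟧ mid = refl
  positive-⟦⟧ (pos i) = dec-true (+ 0 ℤ.<? + letter i) (ℤ.+<+ (1≤letter i))
  positive-⟦⟧ (neg i) = dec-false (+ 0 ℤ.<? - (+ letter i)) (λ 0<-l → ℤ.<-asym 0<-l (-<0 (1≤letter i)))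

  leftHanded-⟦⟧ : ∀ p → normal (leftFace p) ≡ leftward p → leftHanded n ⟦ p ⟧₃ ≡ leftHandedₛ p
  leftHanded-⟦⟧ p@(x , y , z) normal≡ = begin
    leftHanded n ⟦ p ⟧₃
      ≡⟨ cong₂ (λ N X → does (+ 0 ℤ.<? dot (cross N (sub3 X N)) (clamp n ⟦ p ⟧₃))) N≡ X≡ ⟩
    does (+ 0 ℤ.<? dot (leftward p) (clamp n ⟦ p ⟧₃))
      ≡⟨ cong₂ (λ v c → does (+ 0 ℤ.<? dot v c)) (sym normal≡) (clamp-⟦⟧ p) ⟩
    does (+ 0 ℤ.<? dot (normal (leftFace p)) ⟦ clampₛ₃ p ⟧₃)
      ≡⟨ cong (λ t → does (+ 0 ℤ.<? t))
           (trans (dot-normal (leftFace p) ⟦ clampₛ₃ p ⟧₃) (depth-⟦⟧ (leftFace p) (clampₛ₃ p))) ⟩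
    does (+ 0 ℤ.<? ⟦ depthₛ (leftFace p) (clampₛ₃ p) ⟧)
      ≡⟨ positive-⟦⟧ (depthₛ (leftFace p) (clampₛ₃ p)) ⟩
    leftHandedₛ p ∎
    where
    open ≡-Reasoning
    N≡ : sub3 ⟦ p ⟧₃ (clamp n ⟦ p ⟧₃) ≡ (faceStepₛ x , faceStepₛ y , faceStepₛ z)
    N≡ = cong₂ _,_ (faceStep-⟦⟧ x) (cong₂ _,_ (faceStep-⟦⟧ y) (faceStep-⟦⟧ z))
    ext≡ : ∀ s → extZ n (clampZ n ⟦ s ⟧) ≡ cubieExtₛ (clampₛ s)
    ext≡ s = trans (cong (extZ n) (clampZ-⟦⟧ s)) (extZ-⟦⟧ (clampₛ s))
    X≡ : ext n (clamp n ⟦ p ⟧₃) ≡ (cubieExtₛ (clampₛ x) , cubieExtₛ (clampₛ y) , cubieExtₛ (clampₛ z))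
    X≡ = cong₂ _,_ (ext≡ x) (cong₂ _,_ (ext≡ y) (ext≡ z))

-- The lists are explicit so that unification never unfolds the sign of a
-- permutation.
cong-sgn : ∀ l k → l ≡ k → sgn l ≡ sgn k
cong-sgn l k = cong sgn

cong-sgn-* : ∀ l k l′ k′ → l ≡ k → l′ ≡ k′ → sgn l * sgn l′ ≡ sgn k * sgn k′
cong-sgn-* l k l′ k′ refl refl = refl

cong-sgn-*-* : ∀ l k l′ k′ l″ k″ → l ≡ k → l′ ≡ k′ → l″ ≡ k″ →
  sgn l * sgn l′ * sgn l″ ≡ sgn k * sgn k′ * sgn k″
cong-sgn-*-* l k l′ k′ l″ k″ refl refl refl = refl

if-≡ : ∀ b x c → c ≡ b → (if b then 1ℤ else x) ≡ (if c then 1ℤ else x)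
if-≡ b x _ refl = refl

replace-factors : ∀ r x s s′ t t′ → r ≡ x * s * t → s ≡ s′ → t ≡ t′ → r ≡ x * s′ * t′
replace-factors r x s s′ t t′ eq refl refl = eq

all-map-≡ : ∀ {A B : Set} (f : B → ℕ) (g : A → B) ys xs → ys ≡ map g xs →
  All (λ x → f (g x) ≡ 0) xs → All (_≡ 0) (map f ys)
all-map-≡ f g _ xs refl ps = All.map⁺ (All.map⁺ ps)

-- The cube for a fixed odd n

module _ (n : ℕ) (3≤n : 3 ≤ n) (odd : n % 2 ≡ 1) where

  private
    h : ℕ
    h = n / 2

    suc-n : suc n ≡ 2 ℕ.* suc h
    suc-n = trans (cong suc (trans (m≡m%n+[m/n]*n n 2) (cong (ℕ._+ h ℕ.* 2) odd))) (double h)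
      where
      double : ∀ x → suc (1 ℕ.+ x ℕ.* 2) ≡ 2 ℕ.* suc x
      double = solveℕ-∀

    -- The depth of slice `i`; for `i ≤ h` the grid row `i` has coordinate minus this number.
    coord : ℕ → ℕ
    coord i = suc n ℕ.∸ 2 ℕ.* i

    2i≤n : ∀ {i} → i ≤ h → 2 ℕ.* i ≤ n
    2i≤n {i} i≤h = ℕ.≤-trans (ℕ.≤-reflexive (ℕ.*-comm 2 i)) (ℕ.≤-trans (ℕ.*-monoˡ-≤ 2 i≤h) (m/n*n≤m n 2))

    1≤coord : ∀ {i} → i ≤ h → 1 ≤ coord i
    1≤coord i≤h = ℕ.m<n⇒0<n∸m (ℕ.s≤s (2i≤n i≤h))

    coord<n∸1 : ∀ {i} → 2 ≤ i → coord i ℕ.< n ℕ.∸ 1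
    -- From i ≥ 2 the depth is at most n + 1 - 4 = n - 3.
    coord<n∸1 2≤i = ℕ.≤-<-trans (ℕ.∸-monoʳ-≤ (suc n) (ℕ.*-monoʳ-≤ 2 2≤i)) (n∸3<n∸1 3≤n)
      where
      n∸3<n∸1 : ∀ {k} → 3 ≤ k → k ℕ.∸ 3 ℕ.< k ℕ.∸ 1
      n∸3<n∸1 {suc (suc k)} (ℕ.s≤s (ℕ.s≤s 1≤k)) = ℕ.m≤n⇒m≤1+n (∸1-< 1≤k)

    2≤n : 2 ≤ n
    2≤n = ℕ.<⇒≤ 3≤n

    coord-injective : ∀ {i j} → i ≤ h → j ≤ h → coord i ≡ coord j → i ≡ j
    coord-injective {i} {j} i≤h j≤h eq = ℕ.*-cancelˡ-≡ i j 2
      (ℕ.∸-cancelˡ-≡ (ℕ.m≤n⇒m≤1+n (2i≤n i≤h)) (ℕ.m≤n⇒m≤1+n (2i≤n j≤h)) eq)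

    co≡-coord : ∀ {i} → i ≤ h → co n i ≡ - (+ coord i)
    co≡-coord {i} i≤h = trans (ℤ.m-n≡m⊖n (2 ℕ.* i) (suc n)) (ℤ.⊖-≤ (ℕ.m≤n⇒m≤1+n (2i≤n i≤h)))

    co-reflect : ∀ {i} → i ≤ suc n → co n (suc n ℕ.∸ i) ≡ - co n i
    co-reflect {i} i≤ = trans
      (cong (λ s → + (2 ℕ.* j) ℤ.- + s) (sym (ℕ.m∸n+n≡m i≤)))
      (trans (reflect (+ j) (+ i)) (cong (λ s → - (+ (2 ℕ.* i) ℤ.- + s)) (ℕ.m∸n+n≡m i≤)))
      where
      j : ℕ
      j = suc n ℕ.∸ i
      -- With n + 1 = j + i both sides become j - i; `x + (x + 0)` is the form to which `2 * j`
      -- unfolds.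
      reflect : ∀ x y → (x ℤ.+ (x ℤ.+ 0ℤ)) ℤ.- (x ℤ.+ y) ≡ - ((y ℤ.+ (y ℤ.+ 0ℤ)) ℤ.- (x ℤ.+ y))
      reflect = solve-∀

    row≤ : ∀ {i} → i ≤ suc h → i ≤ suc n
    row≤ i≤ = ℕ.≤-trans i≤ (ℕ.≤-trans (ℕ.m≤m+n (suc h) _) (ℕ.≤-reflexive (sym suc-n)))

    co-reflect-coord : ∀ {i} → i ≤ h → co n (suc n ℕ.∸ i) ≡ + coord i
    co-reflect-coord {i} i≤h = trans (co-reflect (row≤ (ℕ.m≤n⇒m≤1+n i≤h)))
      (trans (cong -_ (co≡-coord i≤h)) (ℤ.neg-involutive (+ coord i)))

    co-mid : co n (suc h) ≡ 0ℤ
    co-mid = ℤ.i≡j⇒i-j≡0 (cong +_ (sym suc-n))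

  -- Corners and single edges only have coordinates 0, ±(n - 1) and ±n, so no row letters are
  -- needed.
  module NoRows where
    private
      noRow : Fin 0 → ℕ
      noRow ()

      noRow-injective : ∀ {k l} → noRow k ≡ noRow l → k ≡ l
      noRow-injective {()}

    open Interpretation n 2≤n noRow (λ ()) (λ ()) noRow-injective

    module _ (d : P3 → P3) (valid : Valid n d) where
      private
        w : List (Move 0)
        w = proj₁ (valid-⟦⟧ valid)

        d≗ : ∀ p → d ⟦ p ⟧₃ ≡ ⟦ run w p ⟧₃
        d≗ = proj₂ (valid-⟦⟧ valid)

      sgn-σ≡sgn-τs : sgn (σ n d) ≡ sgn (τs n d)
      sgn-σ≡sgn-τs = begin
        sgn (σ n d)
          ≡⟨ cong-sgn (σ n d) (permₛ corners₀ (run w)) (σ-⟦⟧ {d} {w} d≗ corners₀ refl) ⟩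
        sgn (permₛ corners₀ (run w))
          ≡⟨ sgn-single w ⟩
        sgn (permₛ singleCubies (run w))
          ≡⟨ cong-sgn (τs n d) (permₛ singleCubies (run w)) (τs-⟦⟧ {d} {w} d≗ singleCubies refl) ⟨
        sgn (τs n d) ∎
        where open ≡-Reasoning

      cornerOri-⟦⟧ : ∀ ax c → cornerOri n ax d ⟦ c ⟧₃ ≡ twist ax (run w (pushOutₛ c ax))
      cornerOri-⟦⟧ ax c = trans
        (cong (λ p → let f₀ = pushOut n (clamp n p) ax in
                 if p ==₃ f₀ then 0 else if p ==₃ cw n f₀ then 1 else 2)
          (trans (cong d (pushOut-⟦⟧ c ax)) (d≗ (pushOutₛ c ax))))
        (twist-⟦⟧ ax (run w (pushOutₛ c ax)))

      sum-xo : ∀ ax → sum (xo n ax d) % 3 ≡ 0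
      sum-xo ax = trans (cong (λ l → sum l % 3) xo≡) (Orientation.sum-run (twistOrientation ax) w)
        where
        xo≡ : xo n ax d ≡ map (twist ax ∘ run w) (cornerTrackers ax)
        xo≡ = trans (cong (map (cornerOri n ax d)) cornerCenters-⟦⟧) (map-cong (cornerOri-⟦⟧ ax) corners₀)

      module _ (ref : Fin 12 → Bool) where
        open SingleEdges ref

        choose-⟦⟧ : ∀ b k → choose b (Vec.lookup (singleEdges n) k) ≡ ⟦ chooseₛ b (Vec.lookup singles k) ⟧₃
        choose-⟦⟧ b k = trans
          (cong (choose b) (trans (cong (λ es → Vec.lookup es k) (edgesAt-⟦⟧ mid)) (lookup-map k ⟦_⟧₃² singles)))
          (choose-pair b (Vec.lookup singles k))
          where
          choose-pair : ∀ b pq → choose b ⟦ pq ⟧₃² ≡ ⟦ chooseₛ b pq ⟧₃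
          choose-pair false _ = refl
          choose-pair true _ = refl

        refFacelets-⟦⟧ : refFacelets n ref ≡ map ⟦_⟧₃ (referencesₛ singles ref)
        refFacelets-⟦⟧ = cong Vec.toList (tabulate-cong (λ k → choose-⟦⟧ (ref k) k))

        flip-⟦⟧ : ∀ k → (if member (d (choose (ref k) (Vec.lookup (singleEdges n) k))) (refFacelets n ref) then 0 else 1)
                      ≡ flipₛ (run w) k
        flip-⟦⟧ k = cong (λ b → if b then 0 else 1) (trans
          (cong₂ member (trans (cong d (choose-⟦⟧ (ref k) k)) (d≗ p)) refFacelets-⟦⟧)
          (member-⟦⟧ (referencesₛ singles ref) (run w p)))
          where
          p = chooseₛ (ref k) (Vec.lookup singles k)

        sum-zo : sum (zo n ref d) % 2 ≡ 0
        sum-zo = trans (cong (λ l → sum l % 2) (cong Vec.toList (tabulate-cong flip-⟦⟧))) (sum-flipₛ w)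

  module OneRow (i : ℕ) (2≤i : 2 ≤ i) (i≤h : i ≤ h) where
    private
      row-injective : {k l : Fin 1} → coord i ≡ coord i → k ≡ l
      row-injective {zero} {zero} _ = refl

    open Interpretation n 2≤n (λ _ → coord i) (λ _ → 1≤coord i≤h) (λ _ → coord<n∸1 2≤i) row-injective

    module _ (d : P3 → P3) (valid : Valid n d) where
      private
        w : List (Move 1)
        w = proj₁ (valid-⟦⟧ valid)

        d≗ : ∀ p → d ⟦ p ⟧₃ ≡ ⟦ run w p ⟧₃
        d≗ = proj₂ (valid-⟦⟧ valid)

      sgn-σ≡sgn-ρc : sgn (σ n d) ≡ sgn (ρc n i d)
      sgn-σ≡sgn-ρc = begin
        sgn (σ n d)
          ≡⟨ cong-sgn (σ n d) (permₛ corners₁ (run w)) (σ-⟦⟧ {d} {w} d≗ corners₁ refl) ⟩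
        sgn (permₛ corners₁ (run w))
          ≡⟨ sgn-centerCorners w ⟩
        sgn (permₛ centerCorners₁ (run w))
          ≡⟨ cong-sgn (ρc n i d) (permₛ centerCorners₁ (run w)) (ρc-⟦⟧ {d} {w} d≗ i row₁ centerCorners₁ refl
               (co≡-coord i≤h) (co-reflect-coord i≤h)) ⟨
        sgn (ρc n i d) ∎
        where open ≡-Reasoning

      sgn-ρe-mid : sgn (ρe n i (suc h) d) ≡ sgn (σ n d) * sgn (τc n i d)
      sgn-ρe-mid = begin
        sgn (ρe n i (suc h) d)
          ≡⟨ cong-sgn (ρe n i (suc h) d) (permₛ centerEdges₁ (run w))
               (ρe-⟦⟧ {d} {w} d≗ i (suc h) row₁ mid centerEdges₁ refl (co≡-coord i≤h) (co-reflect-coord i≤h)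
                 co-mid (trans (co-reflect (row≤ ℕ.≤-refl)) (cong -_ co-mid))) ⟩
        sgn (permₛ centerEdges₁ (run w))
          ≡⟨ sgn-centerEdges-mid w ⟩
        sgn (permₛ corners₁ (run w)) * sgn (permₛ coupled₁ (run w))
          ≡⟨ cong-sgn-* (σ n d) (permₛ corners₁ (run w)) (τc n i d) (permₛ coupled₁ (run w))
               (σ-⟦⟧ {d} {w} d≗ corners₁ refl) (τc-⟦⟧ {d} {w} d≗ i row₁ coupled₁ refl (co≡-coord i≤h)) ⟨
        sgn (σ n d) * sgn (τc n i d) ∎
        where open ≡-Reasoning

      handed : ∀ {p} → p ∈ coupledFacelets → leftHanded n ⟦ p ⟧₃ ≡ leftHandedₛ p
      handed {p} p∈ = leftHanded-⟦⟧ p (All.lookup normal-leftFace p∈)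

      leftOf-⟦⟧ : ∀ pq → proj₁ pq ∈ coupledFacelets → leftOf n ⟦ pq ⟧₃² ≡ ⟦ leftOfₛ pq ⟧₃
      leftOf-⟦⟧ (p , q) p∈ = trans (cong (λ b → if b then ⟦ p ⟧₃ else ⟦ q ⟧₃) (handed p∈)) (branch (leftHandedₛ p))
        where
        branch : ∀ b → (if b then ⟦ p ⟧₃ else ⟦ q ⟧₃) ≡ ⟦ if b then p else q ⟧₃
        branch true = refl
        branch false = refl

      leftHanded-run : ∀ pq → LeftFacelet pq → leftHanded n (d (leftOf n ⟦ pq ⟧₃²)) ≡ true
      leftHanded-run pq (p∈ , l∈ , left) = begin
        leftHanded n (d (leftOf n ⟦ pq ⟧₃²))
          ≡⟨ cong (leftHanded n) (trans (cong d (leftOf-⟦⟧ pq p∈)) (d≗ (leftOfₛ pq))) ⟩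
        leftHanded n ⟦ run w (leftOfₛ pq) ⟧₃
          ≡⟨ handed (run-∈ stable-coupledFacelets w l∈) ⟩
        leftHandedₛ (run w (leftOfₛ pq))
          ≡⟨ leftHandedₛ-run w l∈ ⟩
        leftHandedₛ (leftOfₛ pq)
          ≡⟨ left ⟩
        true ∎
        where open ≡-Reasoning

      yo≡0 : All (_≡ 0) (yo n i d)
      yo≡0 = all-map-≡ (λ pr → if leftHanded n (d (leftOf n pr)) then 0 else 1) ⟦_⟧₃²
        (coupledEdges n i) (coupledₛ row₁) (coupledEdges-⟦⟧ i row₁ (co≡-coord i≤h))
        (All.map (λ {pq} l → cong (λ b → if b then 0 else 1) (leftHanded-run pq l)) leftFacelets)

  -- `i ≢ j` keeps the two row letters distinct. The middle row is `mid` rather than a letter, so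
  -- center edges that use it belong to `OneRow`.
  module TwoRows (i j : ℕ) (2≤i : 2 ≤ i) (i≤h : i ≤ h) (2≤j : 2 ≤ j) (j≤h : j ≤ h) (i≢j : i ≢ j) where
    private
      rows : Fin 2 → ℕ
      rows zero = i
      rows (suc zero) = j

      rows≤h : ∀ k → rows k ≤ h
      rows≤h zero = i≤h
      rows≤h (suc zero) = j≤h

      2≤rows : ∀ k → 2 ≤ rows k
      2≤rows zero = 2≤i
      2≤rows (suc zero) = 2≤j

      rows-injective : ∀ {k l} → rows k ≡ rows l → k ≡ l
      rows-injective {zero} {zero} _ = refl
      rows-injective {zero} {suc zero} eq = contradiction eq i≢j
      rows-injective {suc zero} {zero} eq = contradiction (sym eq) i≢j
      rows-injective {suc zero} {suc zero} _ = refl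

      coord-rows-injective : ∀ {k l} → coord (rows k) ≡ coord (rows l) → k ≡ l
      coord-rows-injective {k} {l} eq = rows-injective (coord-injective (rows≤h k) (rows≤h l) eq)

    open Interpretation n 2≤n (coord ∘ rows) (λ k → 1≤coord (rows≤h k)) (λ k → coord<n∸1 (2≤rows k))
      coord-rows-injective

    module _ (d : P3 → P3) (valid : Valid n d) where
      private
        w : List (Move 2)
        w = proj₁ (valid-⟦⟧ valid)

        d≗ : ∀ p → d ⟦ p ⟧₃ ≡ ⟦ run w p ⟧₃
        d≗ = proj₂ (valid-⟦⟧ valid)

      sgn-ρe : sgn (ρe n i j d) ≡ sgn (σ n d) * sgn (τc n i d) * sgn (τc n j d)
      sgn-ρe = begin
        sgn (ρe n i j d)
          ≡⟨ cong-sgn (ρe n i j d) (permₛ centerEdges₂ (run w))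
               (ρe-⟦⟧ {d} {w} d≗ i j row₁ row₂ centerEdges₂ refl (co≡-coord i≤h) (co-reflect-coord i≤h)
                 (co≡-coord j≤h) (co-reflect-coord j≤h)) ⟩
        sgn (permₛ centerEdges₂ (run w))
          ≡⟨ sgn-centerEdges w ⟩
        sgn (permₛ corners₂ (run w)) * sgn (permₛ coupled₂ (run w)) * sgn (permₛ coupled₂′ (run w))
          ≡⟨ cong-sgn-*-* (σ n d) (permₛ corners₂ (run w)) (τc n i d) (permₛ coupled₂ (run w))
               (τc n j d) (permₛ coupled₂′ (run w))
               (σ-⟦⟧ {d} {w} d≗ corners₂ refl) (τc-⟦⟧ {d} {w} d≗ i row₁ coupled₂ refl (co≡-coord i≤h))
               (τc-⟦⟧ {d} {w} d≗ j row₂ coupled₂′ refl (co≡-coord j≤h)) ⟨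
        sgn (σ n d) * sgn (τc n i d) * sgn (τc n j d) ∎
        where open ≡-Reasoning

  sgnτ-coupled : ∀ d j → j ≤ h → sgn (τc n j d) ≡ sgnτ n j d
  sgnτ-coupled d j j≤h = if-≡ false (sgn (τc n j d)) (j ℕ.≡ᵇ suc h)
    -- `j ℕ.≡ᵇ suc h` is the Boolean underlying this decision.
    (dec-false (j ℕ.≟ suc h) (ℕ.<⇒≢ (ℕ.s≤s j≤h)))

  sgnτ-mid : ∀ d → 1ℤ ≡ sgnτ n (suc h) d
  sgnτ-mid d = if-≡ true (sgn (τc n (suc h) d)) (h ℕ.≡ᵇ h) (dec-true (h ℕ.≟ h) refl)

  sgn-ρe-coupled : ∀ d → Valid n d → ∀ i j → 2 ≤ i → i ≤ h → 2 ≤ j → j ≤ h → i ≢ j →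
    sgn (ρe n i j d) ≡ sgn (σ n d) * sgnτ n i d * sgnτ n j d
  sgn-ρe-coupled d valid i j 2≤i i≤h 2≤j j≤h i≢j = replace-factors (sgn (ρe n i j d)) (sgn (σ n d))
    (sgn (τc n i d)) (sgnτ n i d) (sgn (τc n j d)) (sgnτ n j d)
    (TwoRows.sgn-ρe i j 2≤i i≤h 2≤j j≤h i≢j d valid) (sgnτ-coupled d i i≤h) (sgnτ-coupled d j j≤h)

  sgn-ρe-middle : ∀ d → Valid n d → ∀ i j → 2 ≤ i → i ≤ h → j ≡ suc h →
    sgn (ρe n i j d) ≡ sgn (σ n d) * sgnτ n i d * sgnτ n j d
  sgn-ρe-middle d valid i _ 2≤i i≤h refl = replace-factors (sgn (ρe n i (suc h) d)) (sgn (σ n d))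
    (sgn (τc n i d)) (sgnτ n i d) 1ℤ (sgnτ n (suc h) d)
    -- The factor 1 is supplied here because the two-factor relation has no third sign, and `sgnτ`
    -- is 1 at the middle row.
    (*-one (sgn (ρe n i (suc h) d)) (sgn (σ n d) * sgn (τc n i d)) (OneRow.sgn-ρe-mid i 2≤i i≤h d valid))
    (sgnτ-coupled d i i≤h) (sgnτ-mid d)
    where
    *-one : ∀ r x → r ≡ x → r ≡ x * 1ℤ
    *-one r x eq = trans eq (sym (ℤ.*-identityʳ x))

  sgn-ρe : ∀ d → Valid n d → ∀ i j → 2 ≤ i → i ≤ h → 2 ≤ j → j ≤ suc h → i ≢ j →
    sgn (ρe n i j d) ≡ sgn (σ n d) * sgnτ n i d * sgnτ n j d
  sgn-ρe d valid i j 2≤i i≤h 2≤j j≤1+h i≢j =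
    [ (λ { (ℕ.s≤s j≤h) → sgn-ρe-coupled d valid i j 2≤i i≤h 2≤j j≤h i≢j })
    , sgn-ρe-middle d valid i j 2≤i i≤h ]′ (ℕ.m≤n⇒m<n∨m≡n j≤1+h)

theorem8 : (n : ℕ) → 3 ≤ n → n % 2 ≡ 1 →
    (d : P3 → P3) → Valid n d →
    ((sgn (σ n d) ≡ sgn (τs n d))
    × (∀ i → 2 ≤ i → i ≤ n / 2 → sgn (σ n d) ≡ sgn (ρc n i d)))
    × (∀ i j → 2 ≤ i → i ≤ n / 2 → 2 ≤ j → j ≤ suc (n / 2) → i ≢ j →
    sgn (ρe n i j d) ≡ sgn (σ n d) * sgnτ n i d * sgnτ n j d)
    × (∀ (ax : Fin 3) → sum (xo n ax d) % 3 ≡ 0)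
    × (∀ (ref : Fin 12 → Bool) → sum (zo n ref d) % 2 ≡ 0)
    × (∀ i → 2 ≤ i → i ≤ n / 2 → All (_≡ 0) (yo n i d))
theorem8 n 3≤n odd d valid =
    (NoRows.sgn-σ≡sgn-τs n 3≤n odd d valid
      , λ i 2≤i i≤h → OneRow.sgn-σ≡sgn-ρc n 3≤n odd i 2≤i i≤h d valid)
  , sgn-ρe n 3≤n odd d valid
  , NoRows.sum-xo n 3≤n odd d valid
  , NoRows.sum-zo n 3≤n odd d valid
  , λ i 2≤i i≤h → OneRow.yo≡0 n 3≤n odd i 2≤i i≤h d valid
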